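{- For every integer $n\ge1$, the zigzag map $\zeta^{\mathrm{alt}}_{\mathrm B}$ on $\mathcal{PT}_{\mathrm B}(n)$ is equal to $\varphi\circ\Phi_{\mathrm B}$; that is, for every $T\in\mathcal{PT}_{\mathrm B}(n)$, $\zeta^{\mathrm{alt}}_{\mathrm B}(T)$ and $\varphi(\Phi_{\mathrm B}(T))$ are the same permutation of the set $R(T)$ (which is the set of integers appearing in $\Phi_{\mathrm B}(T)$).
   Context: Shifted Ferrers diagrams: a Ferrers diagram $F$ of length $n$ (rows plus columns, empty rows and columns allowed) has its south-east border steps labeled $1,\dots,n$ from north-east to south-west; a row gets the label of its south step, a column the label of its west step. So $F$ amounts to a splitting of $\{1,\dots,n\}$ into row labels and column labels; rows go top to bottom in increasing label order, columns left to right in decreasing label order, and there is a cell in Row $r$, Column $c$ iff $r<c$. If $F$ has $k$ columns, the shifted Ferrers diagram $\overline F$ is obtained by adding $k$ left-justified rows of sizes $1,2,\dots,k$ (top to bottom) above $F$; its length is that of $F$. The rightmost cells of the added rows are the diagonal cells. The added row whose diagonal cell is in Column $j$ is labeled $-j$; thus Row $-j$ has a cell in Column $c$ iff $c\ge j$ ($c$ a column label), and rows are again ordered top to bottom by increasing label. Type B permutation tableaux: $\mathcal{PT}_{\mathrm B}(n)$ is the set of shifted Ferrers diagrams of length $n$ with a $0,1$-filling such that (1) each column has at least one $1$; (2) there is no $0$ having both a $1$ above it in the same column and a $1$ to the left of it in the same row; (3) if a diagonal cell contains $0$, there is no $1$ to the left of it in the same row. A $0$ is restricted if it has a $1$ above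 it in the same column or it is in a diagonal cell. A row is unrestricted if it contains no restricted $0$. Alternative representation of $T\in\mathcal{PT}_{\mathrm B}(n)$: replace each topmost $1$ (topmost $1$ of its column) by $\uparrow$ and each rightmost restricted $0$ (rightmost restricted $0$ of its row) by $\leftarrow$, erase all other entries, and then cut each diagonal cell along its north-west to south-east diagonal, discarding any arrows in diagonal cells. So arrows remain only in non-diagonal cells, each column has at most one $\uparrow$, and Column $c$ has no $\uparrow$ exactly when the diagonal cell of Column $c$ contains a $1$. $B_n$ is the set of type B permutations: words obtained from a permutation of $\{1,\dots,n\}$ by negating any subset of its entries. The map $\Phi_{\mathrm B}:\mathcal{PT}_{\mathrm B}(n)\to B_n$: let $T$ (in alternative representation) have columns labeled $c_1<\cdots<c_k$. Let $\pi^{(k+1)}$ be the word of the labels of the unrestricted rows of $T$ in increasing order. For $i=k,k-1,\dots,1$, obtain $\pi^{(i)}$ from $\pi^{(i+1)}$ as follows. If Column $c_i$ has a $\uparrow$, in Row $r_0$ say, insert $c_i$ immediately before $r_0$; if not, do nothing (in this case $-c_i$ is already in the word). Then, if $r_1<\cdots<r_s$ are the labels of the rows containing a $\leftarrow$ in Column $c_i$, insert $r_1,\dots,r_s$ in this order immediately before $c_i$ (if Column $c_i$ has a $\uparrow$) or before $-c_i$ (if not). Set $\Phi_{\mathrm B}(T)=\pi^{(1)}$. The map $\varphi$: for a word $w=w_1\cdots w_n$ of distinct integers, $w_i$ is an RL-minimum if $w_i<w_j$ for all $j>i$. If $w_{i_1},\dots,w_{i_k}$ with $i_1<\cdots<i_k=n$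 are the RL-minima, $\varphi(w)$ is the permutation of the set $\{w_1,\dots,w_n\}$ with cycles $(w_1,\dots,w_{i_1}),(w_{i_1+1},\dots,w_{i_2}),\dots,(w_{i_{k-1}+1},\dots,w_{i_k})$, where $(a_1,\dots,a_p)$ sends $a_1\mapsto a_2\mapsto\cdots\mapsto a_p\mapsto a_1$. The zigzag map: for $i\in\{1,\dots,n\}$ put $i_T=-i$ if $i$ is the label of a column having no $\uparrow$ in the alternative representation, and $i_T=i$ otherwise. Let $R(T)=\{1_T,\dots,n_T\}$. For each $i\in\{1,\dots,n\}$, exactly one of Row $i$ (if $i$ is a row label) and Row $-i$ (if $i$ is a column label) exists; consider the path entering from the left end of this row travelling east, which switches direction between east and south each time it meets a cell containing an arrow, and which turns from east to south when it reaches the diagonal (i.e. when travelling east along a Row $-j$ it reaches the diagonal cell in Column $j$, it continues south down Column $j$), until it exits the diagram at the right end of a Row $j$ ($j>0$) or the bottom of a Column $j$. Then $\zeta^{\mathrm{alt}}_{\mathrm B}(T)$ is the permutation of $R(T)$ sending $i_T$ to $j_T$. (It is identified with an element of $B_n$ by listing the images of $1_T,2_T,\dots,n_T$.) -}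

module Defs where

open import Data.Nat.Base using (ℕ; suc)
open import Data.Integer.Base as ℤ using (ℤ; +_; -_; ∣_∣)
import Data.Integer.Properties as ℤₚ
open import Data.Fin.Base using (Fin; toℕ; _<_; _≤_)
open import Data.Fin.Patterns using (0F; 1F)
open import Data.Fin.Properties using (_≟_; _<?_; _≤?_; any?; all?)
open import Data.List.Base
  using (List; []; _∷_; [_]; _++_; map; filter; reverse; allFin; applyUpTo; foldl; head; last)
open import Data.List.Membership.Propositional using (_∈_)
import Data.List.Relation.Unary.All as All
open import Data.List.Relation.Unary.Any using (Any)
open import Data.List.Relation.Binary.Permutation.Propositional using (_↭_)
open import Data.Maybe.Base as Maybe using (Maybe; just; nothing; _>>=_)
open import Data.Product.Base using (Σ; ∃; ∃₂; _×_; _,_; proj₂)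
open import Data.Product using (∃!)
open import Data.Sum.Base using (_⊎_; inj₁; inj₂)
open import Data.Vec.Base using (Vec; lookup)
open import Relation.Binary.PropositionalEquality using (_≡_; _≢_; refl)
open import Relation.Nullary.Decidable using (Dec; yes; no; ¬?; _×-dec_; _⊎-dec_; map′)
open import Relation.Nullary.Negation using (¬_)

data Kind : Set where
  row col : Kind

_≟ᴷ_ : (a b : Kind) → Dec (a ≡ b)
row ≟ᴷ row = yes refl
row ≟ᴷ col = no λ ()
col ≟ᴷ row = no λ ()
col ≟ᴷ col = yes refl

-- A Ferrers diagram of length n, as the splitting of the border labels
-- 1,…,n into row labels and column labels.  The label l is represented by
-- the element l − 1 of Fin n.
Shape : ℕ → Set
Shape n = Vec Kind n

label : ∀ {n} → Fin n → ℤ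
label i = + suc (toℕ i)

module _ {n : ℕ} (F : Shape n) where

  kind : Fin n → Kind
  kind = lookup F

  -- The rows of the shifted diagram are indexed by Fin n: index i stands
  -- for Row i if i is a row label and for the added Row −i if i is a
  -- column label.
  rowLabel : Fin n → ℤ
  rowLabel i with kind i
  ... | row = label i
  ... | col = - label i

  Above : Fin n → Fin n → Set
  Above i j = rowLabel i ℤ.< rowLabel j

  above? : ∀ i j → Dec (Above i j)
  above? i j = rowLabel i ℤₚ.<? rowLabel j

  -- Cell i c: the row with index i has a cell in Column c.  The diagonal
  -- cells are exactly the cells with i ≡ c.
  data Cell (i c : Fin n) : Set where
    ordinary : kind i ≡ row → kind c ≡ col → i < c → Cell i c
    added    : kind i ≡ col → kind c ≡ col → i ≤ c → Cell i c

  cell? : ∀ i c → Dec (Cell i c)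
  cell? i c = map′ to from
    (((kind i ≟ᴷ row) ×-dec (kind c ≟ᴷ col) ×-dec (i <? c))
      ⊎-dec ((kind i ≟ᴷ col) ×-dec (kind c ≟ᴷ col) ×-dec (i ≤? c)))
    where
    to : _ → Cell i c
    to (inj₁ (p , q , r)) = ordinary p q r
    to (inj₂ (p , q , r)) = added p q r
    from : Cell i c → _
    from (ordinary p q r) = inj₁ (p , q , r)
    from (added p q r)    = inj₂ (p , q , r)

  -- Column labels decrease from left to right.
  columnsLeftToRight : List (Fin n)
  columnsLeftToRight = filter (λ c → kind c ≟ᴷ col) (reverse (allFin n))

  -- Row labels increase from top to bottom: the rows −c, from the largest
  -- column label c to the smallest, come before the rows with positive label.
  rowsTopToBottom : List (Fin n)
  rowsTopToBottom =
    columnsLeftToRight ++ filter (λ i → kind i ≟ᴷ row) (allFin n)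

record Filling (n : ℕ) : Set where
  field
    shape : Shape n
    entry : ∀ {i c} → .(Cell shape i c) → Fin 2

module _ {n : ℕ} (T : Filling n) where
  open Filling T

  HasEntry : Fin 2 → Fin n → Fin n → Set
  HasEntry b i c = Σ (Cell shape i c) λ p → entry p ≡ b

  hasEntry? : ∀ b i c → Dec (HasEntry b i c)
  hasEntry? b i c with cell? shape i c
  ... | no ¬p = no λ (p , _) → ¬p p
  ... | yes p = map′ (p ,_) proj₂ (entry p ≟ b)

  Zero One : Fin n → Fin n → Set
  Zero = HasEntry 0F
  One  = HasEntry 1F

  OneAbove : Fin n → Fin n → Set
  OneAbove i c = ∃ λ j → Above shape j i × One j c

  oneAbove? : ∀ i c → Dec (OneAbove i c)
  oneAbove? i c = any? λ j → above? shape j i ×-dec hasEntry? 1F j c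

  OneToTheLeft : Fin n → Fin n → Set
  OneToTheLeft i c = ∃ λ d → c < d × One i d

  record IsPermutationTableau : Set where
    field
      column-has-one : ∀ c → kind shape c ≡ col → ∃ λ i → One i c
      no-bad-zero    : ∀ i c → Zero i c → ¬ (OneAbove i c × OneToTheLeft i c)
      diagonal-zero  : ∀ c → Zero c c → ¬ OneToTheLeft c c

  Restricted : Fin n → Fin n → Set
  Restricted i c = Zero i c × (OneAbove i c ⊎ i ≡ c)

  restricted? : ∀ i c → Dec (Restricted i c)
  restricted? i c = hasEntry? 0F i c ×-dec (oneAbove? i c ⊎-dec (i ≟ c))

  Unrestricted : Fin n → Set
  Unrestricted i = ∀ c → ¬ Restricted i c

  unrestricted? : ∀ i → Dec (Unrestricted i)
  unrestricted? i = all? λ c → ¬? (restricted? i c)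

  -- Arrows of the alternative representation; i ≢ c because arrows in
  -- diagonal cells are discarded.
  Up : Fin n → Fin n → Set
  Up i c = i ≢ c × One i c × ¬ OneAbove i c

  up? : ∀ i c → Dec (Up i c)
  up? i c = ¬? (i ≟ c) ×-dec hasEntry? 1F i c ×-dec ¬? (oneAbove? i c)

  Left : Fin n → Fin n → Set
  Left i c = i ≢ c × Restricted i c × ¬ (∃ λ d → d < c × Restricted i d)

  left? : ∀ i c → Dec (Left i c)
  left? i c = ¬? (i ≟ c) ×-dec restricted? i c
    ×-dec ¬? (any? λ d → (d <? c) ×-dec restricted? i d)

  Arrow : Fin n → Fin n → Set
  Arrow i c = Up i c ⊎ Left i c

  arrow? : ∀ i c → Dec (Arrow i c)
  arrow? i c = up? i c ⊎-dec left? i c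

  HasUp : Fin n → Set
  HasUp c = ∃ λ i → Up i c

  hasUp? : ∀ c → Dec (HasUp c)
  hasUp? c = any? λ i → up? i c

record PTB (n : ℕ) : Set where
  field
    filling : Filling n
    isPermutationTableau : IsPermutationTableau filling
  open Filling filling public

Word : Set
Word = List ℤ

TypeBPermutation : ℕ → Word → Set
TypeBPermutation n w = map ∣_∣ w ↭ applyUpTo suc n

-- Insert xs immediately before the letter a; undefined if a does not occur.
insertBefore : Word → ℤ → Word → Maybe Word
insertBefore xs a [] = nothing
insertBefore xs a (y ∷ w) with y ℤₚ.≟ a
... | yes _ = just (xs ++ y ∷ w)
... | no  _ = Maybe.map (y ∷_) (insertBefore xs a w)

module _ {n : ℕ} (T : PTB n) where
  open PTB T

  initialWord : Word
  initialWord =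
    map (rowLabel shape) (filter (unrestricted? filling) (rowsTopToBottom shape))

  leftArrowRows : Fin n → Word
  leftArrowRows c =
    map (rowLabel shape) (filter (λ i → left? filling i c) (rowsTopToBottom shape))

  insertColumn : Word → Fin n → Maybe Word
  insertColumn w c with hasUp? filling c
  ... | yes (r₀ , _) =
    insertBefore [ label c ] (rowLabel shape r₀) w
      >>= insertBefore (leftArrowRows c) (label c)
  ... | no _ = insertBefore (leftArrowRows c) (- label c) w

  -- The columns are treated in decreasing order of labels, i.e. from left
  -- to right.  Φ T ≡ nothing would mean that some insertion is impossible.
  Φ : Maybe Word
  Φ = foldl (λ w c → w >>= λ v → insertColumn v c)
            (just initialWord) (columnsLeftToRight shape)

-- Permutations of a finite set of integers are represented by their graphs.
Graph : Set₁
Graph = ℤ → ℤ → Set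

record IsPermutationOf (S : List ℤ) (f : Graph) : Set where
  field
    within   : ∀ {x y} → f x y → x ∈ S × y ∈ S
    image    : ∀ {x} → x ∈ S → ∃! _≡_ λ y → f x y
    preimage : ∀ {y} → y ∈ S → ∃! _≡_ λ x → f x y

-- (a₁,…,aₚ) sends each letter to the one following it and aₚ to a₁.
cycle : Word → Graph
cycle a x y = (∃₂ λ u v → a ≡ u ++ x ∷ y ∷ v) ⊎ (last a ≡ just x × head a ≡ just y)

-- Cut the word after each of its RL-minima.
factors : Word → List Word
factors [] = []
factors (x ∷ w) with All.all? (x ℤₚ.<?_) w
... | yes _ = [ x ] ∷ factors w
... | no  _ with factors w
...   | []     = [ [ x ] ]
...   | b ∷ bs = (x ∷ b) ∷ bs

φ : Word → Graph
φ w x y = Any (λ a → cycle a x y) (factors w)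

module _ {n : ℕ} (T : PTB n) where
  open PTB T

  -- signed i is i_T.
  signed : Fin n → ℤ
  signed i with kind shape i | hasUp? filling i
  ... | row | _     = label i
  ... | col | yes _ = label i
  ... | col | no _  = - label i

  R : List ℤ
  R = map signed (allFin n)

  -- travelEast i below right: the path runs east along the row with index i;
  -- `below` lists the rows below it, top to bottom, and `right` the columns
  -- still ahead, left to right.  travelSouth c below right: it runs south
  -- down Column c, with the rows `below` still ahead and the columns `right`
  -- to the right of c.  The lists may contain rows and columns that have no
  -- cell in the current column or row; these carry no arrow there, so they
  -- are passed over.  The result is the label at which the path exits.
  -- A path running along an added row always meets the diagonal, so only
  -- ordinary rows can be exited at the right end.
  mutual
    travelEast : Fin n → List (Fin n) → List (Fin n) → Fin n
    travelEast i below [] = i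
    travelEast i below (c ∷ right) with (i ≟ c) ⊎-dec arrow? filling i c
    ... | yes _ = travelSouth c below right
    ... | no  _ = travelEast i below right

    travelSouth : Fin n → List (Fin n) → List (Fin n) → Fin n
    travelSouth c [] right = c
    travelSouth c (i ∷ below) right with arrow? filling i c
    ... | yes _ = travelEast i below right
    ... | no  _ = travelSouth c below right

  exit : Fin n → Fin n
  exit i = travelEast i (filter (above? shape i) (rowsTopToBottom shape))
                        (columnsLeftToRight shape)

  ζ : Graph
  ζ x y = ∃ λ i → x ≡ signed i × y ≡ signed (exit i)

{-# OPTIONS --safe #-}

-- Once the columns left of c have been treated, each row r in the word stands
-- for the block of letters that later insertions will put in its place.  By
-- recursion over the remaining columns, such a block ends in r, its other
-- letters exceed r, and its first letter is where the zigzag path running east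
-- along r from that point exits.  Inside a block, the letter after i is the exit
-- of the path from i: a row with ← in Column c turns south there and meets the
-- next ← (or leaves through c), and a column with ↑ turns east at the row of ↑.
-- The final word is the concatenation of the blocks of the unrestricted rows, in
-- increasing order; hence these rows are the RL-minima and the blocks the cycles.

module Submission where

open import Defs
open import Data.Nat.Base as ℕ using (ℕ; zero; suc; _≥_)
import Data.Nat.Properties as ℕₚ
open import Data.Integer.Base as ℤ using (ℤ; ∣_∣; -_; -<+; +<+)
import Data.Integer.Properties as ℤₚ
open import Data.Fin.Base using (Fin; toℕ; _<_; _≤_)
open import Data.Fin.Patterns using (0F; 1F)
open import Data.Fin.Properties as Finₚ using (_≟_; toℕ-injective)
open import Data.Fin.Induction using (<-wellFounded; spo-wellFounded)
open import Data.List.Base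
  using (List; []; _∷_; [_]; _++_; _∷ʳ_; map; filter; reverse; foldl; allFin; applyUpTo; tabulate;
         concat; concatMap; head; last; initLast; _∷ʳ′_)
open import Data.List.Properties
  using (∷-injective; ∷ʳ-injective; ++-assoc; ++-identityʳ; unfold-reverse; concatMap-++; concatMap-pure;
         map-++; map-∘; map-cong; map-cong-local; map-tabulate; head-map; last-map;
         filter-++; filter-none; filter-all; filter-accept; filter-reject)
open import Data.List.Membership.Propositional using (_∈_; find)
import Data.List.Membership.DecPropositional as DecMembership
open import Data.List.Membership.Propositional.Properties
  using (∈-++⁺ˡ; ∈-++⁺ʳ; ∈-++⁻; ∈-∃++; ∈-concat⁺; ∈-concat⁻; ∈-concatMap⁻; ∈-filter⁺; ∈-filter⁻;
         ∈-allFin; ∈-map⁺; ∈-map⁻)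
open import Data.List.Membership.Propositional.Properties.WithK using (unique∧set⇒bag)
open import Data.List.Relation.Binary.BagAndSetEquality using (∼bag⇒↭)
open import Data.List.Relation.Binary.Permutation.Propositional
  using (_↭_; ↭-sym; ↭⇒↭ₛ; module PermutationReasoning)
open import Data.List.Relation.Binary.Permutation.Propositional.Properties as Permₚ
  using (shifts; ∈-resp-↭)
import Data.List.Relation.Binary.Permutation.Setoid.Properties as PermSₚ
open import Data.List.Relation.Unary.All as All using (All; []; _∷_)
import Data.List.Relation.Unary.All.Properties as Allₚ
open import Data.List.Relation.Unary.AllPairs as AllPairs using (AllPairs; []; _∷_)
import Data.List.Relation.Unary.AllPairs.Properties as AllPairsₚ
open import Data.List.Relation.Unary.Any as Any using (Any; here; there)
import Data.List.Relation.Unary.Any.Properties as Anyₚ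
open import Data.List.Relation.Unary.Linked using (Linked; [-]; _∷_)
open import Data.List.Relation.Unary.Unique.Propositional using (Unique)
import Data.List.Relation.Unary.Unique.Propositional.Properties as Uniqueₚ
open import Data.Maybe.Base as Maybe using (Maybe; just; _>>=_)
open import Data.Maybe.Properties using (just-injective)
open import Data.Product.Base using (∃; ∃₂; _×_; _,_; proj₁; proj₂)
open import Data.Sum.Base using (_⊎_; inj₁; inj₂; [_,_]′)
open import Data.Empty using (⊥)
open import Function.Base using (_∘_; flip; id; case_of_)
open import Function.Bundles using (_⇔_; mk⇔; module Equivalence)
open import Induction.WellFounded using (WellFounded; Acc; acc)
open import Relation.Binary.Definitions using (tri<; tri≈; tri>)
import Relation.Binary.Construct.On as On
open import Relation.Binary.PropositionalEquality
  using (_≡_; _≢_; refl; sym; trans; cong; cong₂; subst; subst₂; setoid; module ≡-Reasoning)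
open import Relation.Nullary.Decidable using (Dec; yes; no; _×-dec_; _⊎-dec_)
open import Relation.Nullary.Negation using (¬_; contradiction)
open import Relation.Unary using (Decidable)

-- Lists without repetitions.

AllPairs-++⁻ : ∀ {A : Set} {R : A → A → Set} xs {ys} → AllPairs R (xs ++ ys) →
  AllPairs R xs × AllPairs R ys × All (λ x → All (R x) ys) xs
AllPairs-++⁻ []       rs       = [] , rs , []
AllPairs-++⁻ (x ∷ xs) (r ∷ rs) with AllPairs-++⁻ xs rs
... | rxs , rys , rxys = Allₚ.++⁻ˡ xs r ∷ rxs , rys , Allₚ.++⁻ʳ xs r ∷ rxys

Unique-++⇒disjoint : ∀ {A : Set} xs {ys : List A} {x} → Unique (xs ++ ys) → x ∈ xs → ¬ x ∈ ys
Unique-++⇒disjoint xs u x∈xs x∈ys =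
  All.lookup (All.lookup (proj₂ (proj₂ (AllPairs-++⁻ xs u))) x∈xs) x∈ys refl

-- A letter that does not repeat fixes the position of the cut; this is what makes the successor
-- relation of a word single-valued.
split-unique : ∀ {A : Set} u u′ {r r′ : List A} {x} → Unique (u ++ x ∷ r) →
  u ++ x ∷ r ≡ u′ ++ x ∷ r′ → u ≡ u′ × r ≡ r′
split-unique []      []       _        eq = refl , proj₂ (∷-injective eq)
split-unique []      (_ ∷ u′) (x∉ ∷ _) eq with refl , eq′ ← ∷-injective eq =
  contradiction refl (All.lookup (subst (All _) eq′ x∉) (∈-++⁺ʳ u′ (here refl)))
split-unique (_ ∷ u) []       (x∉ ∷ _) eq with refl , _ ← ∷-injective eq =
  contradiction refl (All.lookup x∉ (∈-++⁺ʳ u (here refl)))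
split-unique (_ ∷ u) (_ ∷ u′) (_ ∷ un) eq with refl , eq′ ← ∷-injective eq
  with refl , r≡ ← split-unique u u′ un eq′ = refl , r≡

-- Words as cyclic permutations.

module _ {A : Set} where

  Adjacent : List A → A → A → Set
  Adjacent a x y = ∃₂ λ u v → a ≡ u ++ x ∷ y ∷ v

  Adjacent-++ : ∀ {a x y} (u v : List A) → Adjacent a x y → Adjacent (u ++ a ++ v) x y
  Adjacent-++ {x = x} {y} u v (p , q , refl) = u ++ p , q ++ v ,
    trans (cong (u ++_) (++-assoc p (x ∷ y ∷ q) v)) (sym (++-assoc u p (x ∷ y ∷ q ++ v)))

  last⇒∷ʳ : ∀ (a : List A) {x} → last a ≡ just x → ∃ λ u → a ≡ u ∷ʳ x
  last⇒∷ʳ (x ∷ [])    eq with refl ← just-injective eq = [] , refl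
  last⇒∷ʳ (x ∷ y ∷ a) eq with u , eq′ ← last⇒∷ʳ (y ∷ a) eq = x ∷ u , cong (x ∷_) eq′

  last-∷ʳ : ∀ (u : List A) {x} → last (u ∷ʳ x) ≡ just x
  last-∷ʳ []          = refl
  last-∷ʳ (_ ∷ [])    = refl
  last-∷ʳ (_ ∷ y ∷ u) = last-∷ʳ (y ∷ u)

  head⇒∷ : ∀ (a : List A) {y} → head a ≡ just y → ∃ λ v → a ≡ y ∷ v
  head⇒∷ (y ∷ a) eq with refl ← just-injective eq = a , refl

  -- Keeps the two clauses of `cycle` apart on the target side: a first letter that also followed
  -- another letter would occur twice.
  ¬Adjacent-head : ∀ {a x y} → Unique a → Adjacent a x y → ¬ head a ≡ just y
  ¬Adjacent-head un (u , v , refl) h with u | head⇒∷ _ h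
  ... | []    | _ , refl with (x∉ ∷ _) ∷ _ ← un = x∉ refl
  ... | _ ∷ u | _ , refl with x∉ ∷ _ ← un = All.lookup x∉ (∈-++⁺ʳ u (there (here refl))) refl

cycle-functional : ∀ {a x y y′} → Unique a → cycle a x y → cycle a x y′ → y ≡ y′
cycle-functional un (inj₁ (u , v , refl)) (inj₁ (u′ , v′ , eq)) =
  proj₁ (∷-injective (proj₂ (split-unique u u′ un eq)))
cycle-functional un (inj₁ (u , v , refl)) (inj₂ (l , _)) with last⇒∷ʳ _ l
... | u′ , eq = contradiction (proj₂ (split-unique u u′ un eq)) λ ()
cycle-functional un (inj₂ (l , _)) (inj₁ (u , v , refl)) with last⇒∷ʳ _ l
... | u′ , eq = contradiction (proj₂ (split-unique u u′ un eq)) λ ()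
cycle-functional un (inj₂ (_ , h)) (inj₂ (_ , h′)) = just-injective (trans (sym h) h′)

cycle-injective : ∀ {a x x′ y} → Unique a → cycle a x y → cycle a x′ y → x ≡ x′
cycle-injective {x = x} {x′} {y} un (inj₁ (u , v , refl)) (inj₁ (u′ , v′ , eq)) =
  -- The cut is made at `y`, with `x` absorbed into the prefix, so that equality of the prefixes
  -- yields equality of their last letters.
  proj₂ (∷ʳ-injective u u′ (proj₁ (split-unique (u ∷ʳ x) (u′ ∷ʳ x′)
    (subst Unique (sym (++-assoc u [ x ] (y ∷ v))) un)
    (trans (++-assoc u [ x ] (y ∷ v)) (trans eq (sym (++-assoc u′ [ x′ ] (y ∷ v′))))))))
cycle-injective un (inj₁ adj) (inj₂ (_ , h)) = contradiction h (¬Adjacent-head un adj)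
cycle-injective un (inj₂ (_ , h)) (inj₁ adj) = contradiction h (¬Adjacent-head un adj)
cycle-injective un (inj₂ (l , _)) (inj₂ (l′ , _)) = just-injective (trans (sym l) l′)

cycle-within : ∀ {a x y} → cycle a x y → x ∈ a × y ∈ a
cycle-within (inj₁ (u , v , refl)) = ∈-++⁺ʳ u (here refl) , ∈-++⁺ʳ u (there (here refl))
cycle-within {a} (inj₂ (l , h)) with last⇒∷ʳ a l | head⇒∷ a h
... | u , refl | v , eq = ∈-++⁺ʳ u (here refl) , subst (_ ∈_) (sym eq) (here refl)

cycle-image : ∀ {a x} → x ∈ a → ∃ λ y → cycle a x y
cycle-image x∈a with ∈-∃++ x∈a
... | u      , y ∷ v , refl = y , inj₁ (u , v , refl)
... | []     , []    , refl = _ , inj₂ (refl , refl)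
... | z ∷ u  , []    , refl = z , inj₂ (last-∷ʳ (z ∷ u) , refl)

cycle-preimage : ∀ {a y} → y ∈ a → ∃ λ x → cycle a x y
cycle-preimage {y = y} y∈a with ∈-∃++ y∈a
... | u , v , refl with initLast u
...   | u′ ∷ʳ′ x = x , inj₁ (u′ , v , ++-assoc u′ [ x ] (y ∷ v))
...   | [] with initLast v
...     | []       = y , inj₂ (refl , refl)
...     | v′ ∷ʳ′ x = x , inj₂ (last-∷ʳ (y ∷ v′) , refl)

-- `φ w` unfolds to `Cycles (factors w)`; an arbitrary list of words leaves room for induction over
-- the factors.
Cycles : List Word → Graph
Cycles bs x y = Any (λ a → cycle a x y) bs

Cycles-within : ∀ {bs x y} → Cycles bs x y → x ∈ concat bs × y ∈ concat bs
Cycles-within c =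
  ∈-concat⁺ (Any.map (proj₁ ∘ cycle-within) c) , ∈-concat⁺ (Any.map (proj₂ ∘ cycle-within) c)

Cycles-functional : ∀ bs {x y y′} → Unique (concat bs) → Cycles bs x y → Cycles bs x y′ → y ≡ y′
Cycles-functional (b ∷ bs) un (here c) (here c′) =
  cycle-functional (proj₁ (AllPairs-++⁻ b un)) c c′
Cycles-functional (b ∷ bs) un (here c) (there c′) =
  contradiction (proj₁ (Cycles-within c′)) (Unique-++⇒disjoint b un (proj₁ (cycle-within c)))
Cycles-functional (b ∷ bs) un (there c) (here c′) =
  contradiction (proj₁ (Cycles-within c)) (Unique-++⇒disjoint b un (proj₁ (cycle-within c′)))
Cycles-functional (b ∷ bs) un (there c) (there c′) =
  Cycles-functional bs (proj₁ (proj₂ (AllPairs-++⁻ b un))) c c′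

Cycles-injective : ∀ bs {x x′ y} → Unique (concat bs) → Cycles bs x y → Cycles bs x′ y → x ≡ x′
Cycles-injective (b ∷ bs) un (here c) (here c′) =
  cycle-injective (proj₁ (AllPairs-++⁻ b un)) c c′
Cycles-injective (b ∷ bs) un (here c) (there c′) =
  contradiction (proj₂ (Cycles-within c′)) (Unique-++⇒disjoint b un (proj₂ (cycle-within c)))
Cycles-injective (b ∷ bs) un (there c) (here c′) =
  contradiction (proj₂ (Cycles-within c)) (Unique-++⇒disjoint b un (proj₂ (cycle-within c′)))
Cycles-injective (b ∷ bs) un (there c) (there c′) =
  Cycles-injective bs (proj₁ (proj₂ (AllPairs-++⁻ b un))) c c′

Cycles-isPermutation : ∀ bs → Unique (concat bs) → IsPermutationOf (concat bs) (Cycles bs)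
Cycles-isPermutation bs un = record
  { within   = Cycles-within
  ; image    = λ x∈ → let c = Any.map cycle-image (∈-concat⁻ bs x∈) ; y , d = Any-∃ c in
                 y , d , Cycles-functional bs un d
  ; preimage = λ y∈ → let c = Any.map cycle-preimage (∈-concat⁻ bs y∈) ; x , d = Any-∃ c in
                 x , d , Cycles-injective bs un d
  }
  where
  Any-∃ : ∀ {bs : List Word} {P : Word → ℤ → Set} →
    Any (λ b → ∃ (P b)) bs → ∃ λ y → Any (λ b → P b y) bs
  Any-∃ (here (y , p)) = y , here p
  Any-∃ (there ps) with y , q ← Any-∃ ps = y , there q

-- Cutting a word at its RL-minima.

concat-factors : ∀ w → concat (factors w) ≡ w
concat-factors [] = refl
concat-factors (x ∷ w) with All.all? (x ℤₚ.<?_) w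
... | yes _ = cong (x ∷_) (concat-factors w)
... | no  _ with factors w | concat-factors w
...   | []     | eq = cong (x ∷_) eq
...   | b ∷ bs | eq = cong (x ∷_) eq

-- `x` is an RL-minimum because everything after it is larger, and no letter of `u` is one because
-- the smaller `x` still follows it. So the first cut falls right after `x`.
factors-∷ʳ-++ : ∀ u {x w} → All (x ℤ.<_) u → All (x ℤ.<_) w →
  factors (u ∷ʳ x ++ w) ≡ (u ∷ʳ x) ∷ factors w
factors-∷ʳ-++ [] {x} {w} _ x<w with All.all? (x ℤₚ.<?_) w
... | yes _  = refl
... | no ¬p  = contradiction x<w ¬p
factors-∷ʳ-++ (z ∷ u) {x} {w} (x<z ∷ x<u) x<w with All.all? (z ℤₚ.<?_) (u ∷ʳ x ++ w)
... | yes z< = contradiction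
  (All.lookup z< (∈-++⁺ˡ (∈-++⁺ʳ u (here refl)))) (ℤₚ.<-asym x<z)
... | no _ rewrite factors-∷ʳ-++ u {x} {w} x<u x<w = refl

φ-isPermutation : ∀ w → Unique w → IsPermutationOf w (φ w)
φ-isPermutation w un = subst (λ s → IsPermutationOf s (φ w)) (concat-factors w)
  (Cycles-isPermutation (factors w) (subst Unique (sym (concat-factors w)) un))

-- Minimal elements and ordered lists.

minimal : ∀ {A : Set} {_⊏_ : A → A → Set} {P : A → Set} → WellFounded _⊏_ →
  (∀ x → Dec (∃ λ y → y ⊏ x × P y)) → ∀ {x} → P x → ∃ λ m → P m × ¬ (∃ λ y → y ⊏ m × P y)
minimal {_⊏_ = _⊏_} {P} wf smaller? px = go px (wf _)
  where
  go : ∀ {x} → P x → Acc _⊏_ x → ∃ λ m → P m × ¬ (∃ λ y → y ⊏ m × P y)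
  go {x} px (acc rec) with smaller? x
  ... | yes (_ , y⊏x , py) = go py (rec y⊏x)
  ... | no  ¬smaller       = x , px , ¬smaller

AllPairs-reverse : ∀ {A : Set} {R : A → A → Set} {xs} → AllPairs R xs → AllPairs (flip R) (reverse xs)
AllPairs-reverse [] = []
AllPairs-reverse {R = R} {x ∷ xs} (r ∷ rs) = subst (AllPairs (flip R)) (sym (unfold-reverse x xs))
  (AllPairsₚ.++⁺ (AllPairs-reverse rs) ([] ∷ [])
    (All.tabulate λ y∈ → All.lookup r (Anyₚ.reverse⁻ y∈) ∷ []))

AllPairs-restrict : ∀ {A : Set} {P : A → Set} {R S : A → A → Set} →
  (∀ {x y} → P x → P y → R x y → S x y) → ∀ {xs} → All P xs → AllPairs R xs → AllPairs S xs
AllPairs-restrict f []       []       = []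
AllPairs-restrict f (p ∷ ps) (r ∷ rs) =
  All.tabulate (λ y∈ → f p (All.lookup ps y∈) (All.lookup r y∈)) ∷ AllPairs-restrict f ps rs

-- Labels, cells and the orders of rows and columns in a shifted diagram.

label-mono-< : ∀ {n} {i j : Fin n} → i < j → label i ℤ.< label j
label-mono-< i<j = +<+ (ℕ.s≤s i<j)

module _ {n} (F : Shape n) where

  rowLabel-row : ∀ {i} → kind F i ≡ row → rowLabel F i ≡ label i
  rowLabel-row {i} k with kind F i
  ... | row = refl

  rowLabel-col : ∀ {i} → kind F i ≡ col → rowLabel F i ≡ - label i
  rowLabel-col {i} k with kind F i
  ... | col = refl

  ∣rowLabel∣ : ∀ i → ∣ rowLabel F i ∣ ≡ suc (toℕ i)
  ∣rowLabel∣ i with kind F i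
  ... | row = refl
  ... | col = refl

  rowLabel-injective : ∀ {i j} → rowLabel F i ≡ rowLabel F j → i ≡ j
  rowLabel-injective {i} {j} eq = toℕ-injective (ℕₚ.suc-injective
    (trans (sym (∣rowLabel∣ i)) (trans (cong ∣_∣ eq) (∣rowLabel∣ j))))

  -- Finiteness of `Fin n` is what counts here: the order of the integers by itself is not well
  -- founded.
  Above-wellFounded : WellFounded (Above F)
  Above-wellFounded = spo-wellFounded
    (On.isStrictPartialOrder (rowLabel F) ℤₚ.<-isStrictPartialOrder)

  cell-col : ∀ {i c} → Cell F i c → kind F c ≡ col
  cell-col (ordinary _ kc _) = kc
  cell-col (added _ kc _)    = kc

  cell-≤ : ∀ {i c} → Cell F i c → i ≤ c
  cell-≤ (ordinary _ _ i<c) = ℕₚ.<⇒≤ i<c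
  cell-≤ (added _ _ i≤c)    = i≤c

  diagonal : ∀ {c} → kind F c ≡ col → Cell F c c
  diagonal kc = added kc kc ℕₚ.≤-refl

  -- The diagonal cell is the top cell of Column `c`: any other row meeting that column has a
  -- positive label or a label `−i` with `i < c`.
  diagonal-Above : ∀ {i c} → Cell F i c → i ≢ c → Above F c i
  diagonal-Above (ordinary ki kc _) _ =
    subst₂ ℤ._<_ (sym (rowLabel-col kc)) (sym (rowLabel-row ki)) -<+
  diagonal-Above (added ki kc i≤c) i≢c =
    subst₂ ℤ._<_ (sym (rowLabel-col kc)) (sym (rowLabel-col ki))
      (ℤₚ.neg-mono-< (label-mono-< (Finₚ.≤∧≢⇒< i≤c i≢c)))

  rowLabel-<-column : ∀ {i c} → Cell F i c → i ≢ c → rowLabel F i ℤ.< label c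
  rowLabel-<-column (ordinary ki _ i<c) _ = subst (ℤ._< _) (sym (rowLabel-row ki)) (label-mono-< i<c)
  rowLabel-<-column (added ki _ _)      _ = subst (ℤ._< _) (sym (rowLabel-col ki)) -<+

  columns-decreasing : AllPairs (flip _<_) (columnsLeftToRight F)
  columns-decreasing = AllPairsₚ.filter⁺ (λ c → kind F c ≟ᴷ col)
    (AllPairs-reverse (AllPairsₚ.tabulate⁺-< {f = id} id))

  columns-col : All (λ c → kind F c ≡ col) (columnsLeftToRight F)
  columns-col = Allₚ.all-filter (λ c → kind F c ≟ᴷ col) (reverse (allFin n))

  columns-complete : ∀ {c} → kind F c ≡ col → c ∈ columnsLeftToRight F
  columns-complete kc = ∈-filter⁺ (λ c → kind F c ≟ᴷ col) (Anyₚ.reverse⁺ (∈-allFin _)) kc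

  private
    ordinaryRows : List (Fin n)
    ordinaryRows = filter (λ i → kind F i ≟ᴷ row) (allFin n)

    ordinaryRows-row : All (λ i → kind F i ≡ row) ordinaryRows
    ordinaryRows-row = Allₚ.all-filter (λ i → kind F i ≟ᴷ row) (allFin n)

  rows-sorted : AllPairs (Above F) (rowsTopToBottom F)
  rows-sorted = AllPairsₚ.++⁺
    (AllPairs-restrict
      (λ kx ky y<x → subst₂ ℤ._<_ (sym (rowLabel-col kx)) (sym (rowLabel-col ky))
        (ℤₚ.neg-mono-< (label-mono-< y<x)))
      columns-col columns-decreasing)
    (AllPairs-restrict
      (λ kx ky x<y → subst₂ ℤ._<_ (sym (rowLabel-row kx)) (sym (rowLabel-row ky)) (label-mono-< x<y))
      ordinaryRows-row
      (AllPairsₚ.filter⁺ (λ i → kind F i ≟ᴷ row) (AllPairsₚ.tabulate⁺-< {f = id} id)))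
    (All.map (λ kc → All.map
        (λ kr → subst₂ ℤ._<_ (sym (rowLabel-col kc)) (sym (rowLabel-row kr)) -<+) ordinaryRows-row)
      columns-col)

  rows-complete : ∀ i → i ∈ rowsTopToBottom F
  rows-complete i with kind F i in k
  ... | row = ∈-++⁺ʳ (columnsLeftToRight F) (∈-filter⁺ (λ i → kind F i ≟ᴷ row) (∈-allFin i) k)
  ... | col = ∈-++⁺ˡ (columns-complete k)

-- Arrows of a tableau, and the column at which each letter is inserted.

module Geometry {n} (T : PTB n) where
  open PTB T public
  open IsPermutationTableau isPermutationTableau public

  Zero∧One⇒⊥ : ∀ {i c} → Zero filling i c → One filling i c → ⊥
  Zero∧One⇒⊥ (_ , z) (_ , o) with () ← trans (sym z) o

  One-col : ∀ {i c} → One filling i c → kind shape c ≡ col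
  One-col (p , _) = cell-col shape p

  One-≤ : ∀ {i c} → One filling i c → i ≤ c
  One-≤ (p , _) = cell-≤ shape p

  -- A 1 in the diagonal cell would lie above the 1 carrying `↑`, which is topmost.
  HasUp⇒diagonal-zero : ∀ {c} → kind shape c ≡ col → HasUp filling c → Zero filling c c
  HasUp⇒diagonal-zero kc (i , i≢c , (p , _) , ¬above) = go _ refl
    where
    d = diagonal shape kc
    go : ∀ b → entry d ≡ b → Zero filling _ _
    go 0F e = d , e
    go 1F e = contradiction (_ , diagonal-Above shape p i≢c , d , e) ¬above

  -- Fails exactly when i_T differs from the row label −i; Row −i is then all zeros
  -- and −i never occurs in a word.
  Plain : Fin n → Set
  Plain i = ¬ (kind shape i ≡ col × HasUp filling i)

  -- The diagonal 0 of Row `−i` forbids, by `diagonal-zero`, every 1 to its left, and that row has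
  -- no cell further right.
  One⇒Plain : ∀ {i c} → One filling i c → Plain i
  One⇒Plain {i} {c} o (ki , up) with i ≟ c | HasUp⇒diagonal-zero ki up
  ... | yes refl | z = Zero∧One⇒⊥ z o
  ... | no i≢c   | z = diagonal-zero i z (c , Finₚ.≤∧≢⇒< (One-≤ o) i≢c , o)

  -- If Column `i` has `↑`, the rightmost restricted 0 of Row `−i` is the diagonal one, whose arrow
  -- is discarded.
  Left⇒Plain : ∀ {i c} → Left filling i c → Plain i
  Left⇒Plain (i≢c , ((p , _) , _) , ¬smaller) (ki , up) =
    ¬smaller (_ , Finₚ.≤∧≢⇒< (cell-≤ shape p) i≢c , HasUp⇒diagonal-zero ki up , inj₂ refl)

  Unrestricted⇒Plain : ∀ {i} → Unrestricted filling i → Plain i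
  Unrestricted⇒Plain un (ki , up) = un _ (HasUp⇒diagonal-zero ki up , inj₂ refl)

  signed-plain : ∀ {i} → Plain i → signed T i ≡ rowLabel shape i
  signed-plain {i} pl with kind shape i | hasUp? filling i
  ... | row | _      = refl
  ... | col | yes up = contradiction (refl , up) pl
  ... | col | no _   = refl

  signed-up : ∀ {i} → HasUp filling i → signed T i ≡ label i
  signed-up {i} up with kind shape i | hasUp? filling i
  ... | row | _     = refl
  ... | col | yes _ = refl
  ... | col | no ¬u = contradiction up ¬u

  ∣signed∣ : ∀ i → ∣ signed T i ∣ ≡ suc (toℕ i)
  ∣signed∣ i with kind shape i | hasUp? filling i
  ... | row | _     = refl
  ... | col | yes _ = refl
  ... | col | no _  = refl

  signed-injective : ∀ {i j} → signed T i ≡ signed T j → i ≡ j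
  signed-injective {i} {j} eq = toℕ-injective (ℕₚ.suc-injective
    (trans (sym (∣signed∣ i)) (trans (cong ∣_∣ eq) (∣signed∣ j))))

  Topmost : Fin n → Fin n → Set
  Topmost i c = One filling i c × ¬ OneAbove filling i c

  opaque
    -- The row in front of whose letter Column `c` makes its insertions: the row of `↑`, or Row `−c`
    -- when there is none. The two cases of the insertion rule thereby become one.
    top : Fin n → Fin n
    top c with hasUp? filling c
    ... | yes (r , _) = r
    ... | no  _       = c

    -- Without `↑` a topmost 1 cannot lie off the diagonal, so the one obtained from
    -- `column-has-one` sits in the diagonal cell.
    top-topmost : ∀ {c} → kind shape c ≡ col → Topmost (top c) c
    top-topmost {c} kc with hasUp? filling c
    ... | yes (_ , _ , o , ¬above) = o , ¬above
    ... | no ¬up with minimal (Above-wellFounded shape) (λ i → oneAbove? filling i c) (proj₂ (column-has-one c kc))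
    ...   | i , o , ¬above with i ≟ c
    ...     | yes refl = o , ¬above
    ...     | no i≢c   = contradiction (i , i≢c , o , ¬above) ¬up

    top-plain : ∀ {c} → kind shape c ≡ col → Plain (top c)
    top-plain kc = One⇒Plain (proj₁ (top-topmost kc))

    Up⇒top : ∀ {i c} → Up filling i c → top c ≡ i
    Up⇒top {i} {c} (_ , o , ¬above) with top-topmost (One-col o)
    ... | o′ , ¬above′ with ℤₚ.<-cmp (rowLabel shape (top c)) (rowLabel shape i)
    ...   | tri< a _ _ = contradiction (_ , a , o′) ¬above
    ...   | tri≈ _ e _ = rowLabel-injective shape e
    ...   | tri> _ _ a = contradiction (_ , a , o) ¬above′

    HasUp⇒top-Up : ∀ {c} → HasUp filling c → Up filling (top c) c
    HasUp⇒top-Up {c} up with hasUp? filling c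
    ... | yes (_ , up′) = up′
    ... | no ¬up        = contradiction up ¬up

    ¬HasUp⇒top : ∀ {c} → ¬ HasUp filling c → top c ≡ c
    ¬HasUp⇒top {c} ¬up with hasUp? filling c
    ... | yes up = contradiction up ¬up
    ... | no _   = refl

  Left⇒OneAbove : ∀ {i c} → Left filling i c → OneAbove filling i c
  Left⇒OneAbove (i≢c , (_ , inj₁ above) , _) = above
  Left⇒OneAbove (i≢c , (_ , inj₂ i≡c) , _)   = contradiction i≡c i≢c

  -- Off the diagonal, a restricted 0 has a 1 above it, and the topmost 1 is at least as high.
  Left⇒below-top : ∀ {i c} → Left filling i c → Above shape (top c) i
  Left⇒below-top l with Left⇒OneAbove l
  ... | j , j<i , o = ℤₚ.≤-<-trans
    (ℤₚ.≮⇒≥ λ j<t → proj₂ (top-topmost (One-col o)) (j , j<t , o)) j<i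

  -- The letter j enters the word when column c is treated.
  Born : Fin n → Fin n → Set
  Born j c = Left filling j c ⊎ (j ≡ c × HasUp filling c)

  -- Read with `cs` as the columns still to be treated: the letter of `j` is already in the word.
  -- Unrestricted rows are there from the start and are never born.
  Alive : List (Fin n) → Fin n → Set
  Alive cs j = All (λ c → ¬ Born j c) cs

  -- A row has only one rightmost restricted 0, and an index cannot be born in both ways, since `←`
  -- in Row `−j` excludes `↑` in Column `j`.
  Born-functional : ∀ {j c d} → kind shape c ≡ col → kind shape d ≡ col → Born j c → Born j d → c ≡ d
  Born-functional {c = c} {d} kc kd (inj₁ (_ , r , ¬r)) (inj₁ (_ , r′ , ¬r′)) with Finₚ.<-cmp c d
  ... | tri< c<d _ _ = contradiction (c , c<d , r) ¬r′
  ... | tri≈ _ e _   = e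
  ... | tri> _ _ d<c = contradiction (d , d<c , r′) ¬r
  Born-functional kc kd (inj₁ l) (inj₂ (refl , up)) =
    contradiction (kd , up) (Left⇒Plain l)
  Born-functional kc kd (inj₂ (refl , up)) (inj₁ l) =
    contradiction (kc , up) (Left⇒Plain l)
  Born-functional kc kd (inj₂ (refl , _)) (inj₂ (refl , _)) = refl

  unrestricted⇒unborn : ∀ {i c} → kind shape c ≡ col → Unrestricted filling i → ¬ Born i c
  unrestricted⇒unborn kc un (inj₁ (_ , r , _))   = un _ r
  unrestricted⇒unborn kc un (inj₂ (refl , up)) = Unrestricted⇒Plain un (kc , up)

  -- A row with a restricted 0 has a rightmost one, the one with the least column label. Off the
  -- diagonal it is a `←`. On the diagonal, either the column has `↑` and its own letter is born
  -- there, or its topmost 1 is the diagonal cell, which holds 0.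
  unborn⇒unrestricted : ∀ {i} → (∀ c → kind shape c ≡ col → ¬ Born i c) → Unrestricted filling i
  unborn⇒unrestricted {i} ¬born c r
    with minimal <-wellFounded
           (λ d → Finₚ.any? λ e → (e Finₚ.<? d) ×-dec restricted? filling i e) r
  ... | d , r′@((p , z) , _) , ¬smaller with i ≟ d
  ...   | no i≢d = ¬born d (cell-col shape p) (inj₁ (i≢d , r′ , ¬smaller))
  ...   | yes refl with hasUp? filling i
  ...     | yes up = ¬born i (cell-col shape p) (inj₂ (refl , up))
  ...     | no ¬up = Zero∧One⇒⊥ (p , z)
    (subst (λ j → One filling j i) (¬HasUp⇒top ¬up) (proj₁ (top-topmost (cell-col shape p))))

  -- A `←` of row `top c` in a column to the right of `c` would be a 0 with a 1 above it and the
  -- topmost 1 of Column `c` to its left, against `no-bad-zero`. This guarantees that `top c` is in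
  -- the word when Column `c` needs it.
  top-unborn : ∀ {c d} → d ≤ c → kind shape c ≡ col → kind shape d ≡ col → ¬ Born (top c) d
  top-unborn {c} {d} d≤c kc kd (inj₁ l@(_ , (z , _) , _)) with d ≟ c
  ... | yes refl = Zero∧One⇒⊥ z (proj₁ (top-topmost kc))
  ... | no d≢c   = no-bad-zero _ _ z
    (Left⇒OneAbove l , c , Finₚ.≤∧≢⇒< d≤c d≢c , proj₁ (top-topmost kc))
  top-unborn {c} {d} d≤c kc kd (inj₂ (refl , up)) = top-plain kc (kd , up)

  top≢later : ∀ {c d} → d < c → kind shape d ≡ col → top d ≢ c
  top≢later d<c kd refl = ℕₚ.<⇒≱ d<c (One-≤ (proj₁ (top-topmost kd)))

  -- The source of the RL-minima: every letter is inserted in front of a smaller one. A `←` lies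
  -- below the topmost 1, and a column label exceeds the label of every row meeting that column off
  -- the diagonal.
  Born⇒top-≺ : ∀ {j c} → kind shape c ≡ col → Born j c → signed T (top c) ℤ.< signed T j
  Born⇒top-≺ kc (inj₁ l) = subst₂ ℤ._<_ (sym (signed-plain (top-plain kc)))
    (sym (signed-plain (Left⇒Plain l))) (Left⇒below-top l)
  Born⇒top-≺ kc (inj₂ (refl , up)) = subst₂ ℤ._<_ (sym (signed-plain (top-plain kc)))
    (sym (signed-up up))
    (rowLabel-<-column shape (proj₁ (proj₁ (top-topmost kc))) (proj₁ (HasUp⇒top-Up up)))

-- Selection from ordered lists.

headOr : ∀ {A : Set} → List A → A → A
headOr []      d = d
headOr (x ∷ _) d = x

filter-cong-local : ∀ {A : Set} {P Q : A → Set} (P? : Decidable P) (Q? : Decidable Q) {xs} →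
  All (λ x → (P x → Q x) × (Q x → P x)) xs → filter P? xs ≡ filter Q? xs
filter-cong-local P? Q? [] = refl
filter-cong-local P? Q? {x ∷ xs} ((f , g) ∷ fgs) with P? x | Q? x
... | yes _ | yes _ = cong (x ∷_) (filter-cong-local P? Q? fgs)
... | yes p | no ¬q = contradiction (f p) ¬q
... | no ¬p | yes q = contradiction (g q) ¬p
... | no _  | no _  = filter-cong-local P? Q? fgs

headOr-filter-sorted : ∀ {A : Set} {P : A → Set} {R : A → A → Set} (P? : Decidable P) {xs t d} →
  AllPairs R xs → t ∈ xs → P t → (∀ {x} → P x → ¬ R x t) → headOr (filter P? xs) d ≡ t
headOr-filter-sorted P? {x ∷ xs} (r ∷ rs) t∈ pt first with P? x | t∈
... | yes _  | here refl = refl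
... | yes px | there t∈′ = contradiction (All.lookup r t∈′) (first px)
... | no ¬px | here refl = contradiction pt ¬px
... | no _   | there t∈′ = headOr-filter-sorted P? rs t∈′ pt first

filter-sorted : ∀ {A : Set} {R : A → A → Set} (R? : ∀ x y → Dec (R x y)) →
  (∀ {x y} → R x y → ¬ R y x) → ∀ p {x q} →
  AllPairs R (p ++ x ∷ q) → filter (R? x) (p ++ x ∷ q) ≡ q
filter-sorted R? asym p {x} {q} rs with AllPairs-++⁻ p rs
... | _ , rx ∷ _ , rp = trans (filter-++ (R? x) p (x ∷ q)) (cong₂ _++_
  (filter-none (R? x) (All.map (λ r → asym (All.head r)) rp))
  (trans (filter-reject (R? x) (λ r → asym r r)) (filter-all (R? x) rx)))

-- Blocks of the final word.

module Zigzag {n} (T : PTB n) where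
  open Geometry T public

  rows cols : List (Fin n)
  rows = rowsTopToBottom shape
  cols = columnsLeftToRight shape

  rows-unique : Unique rows
  rows-unique = AllPairs.map (λ { r refl → ℤₚ.<-irrefl refl r }) (rows-sorted shape)

  Suffix : List (Fin n) → Set
  Suffix cs = ∃ λ p → cols ≡ p ++ cs

  Suffix-tail : ∀ {c cs} → Suffix (c ∷ cs) → Suffix cs
  Suffix-tail {c} {cs} (p , eq) = p ∷ʳ c , trans eq (sym (++-assoc p [ c ] cs))

  Suffix-col : ∀ {cs} → Suffix cs → All (λ d → kind shape d ≡ col) cs
  Suffix-col (p , eq) = Allₚ.++⁻ʳ p (subst (All _) eq (columns-col shape))

  Suffix-ordered : ∀ {c cs} (s : Suffix (c ∷ cs)) → All (c <_) (proj₁ s) × All (_< c) cs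
  Suffix-ordered (p , eq) with AllPairs-++⁻ p (subst (AllPairs _) eq (columns-decreasing shape))
  ... | _ , d<c ∷ _ , rp = All.map All.head rp , d<c

  opaque
    lefts : Fin n → List (Fin n)
    lefts c = filter (λ i → left? filling i c) rows

    newColumn : Fin n → List (Fin n)
    newColumn c with hasUp? filling c
    ... | yes _ = [ c ]
    ... | no  _ = []

  -- In word order: the two insertions of Column `c` together place these letters immediately before
  -- `top c`.
  inserted : Fin n → List (Fin n)
  inserted c = lefts c ++ newColumn c

  opaque
    unfolding lefts newColumn

    ∈-inserted⁻ : ∀ {c j} → j ∈ inserted c → Born j c
    ∈-inserted⁻ {c} j∈ with ∈-++⁻ (lefts c) j∈
    ... | inj₁ j∈l = inj₁ (proj₂ (∈-filter⁻ (λ i → left? filling i c) {xs = rows} j∈l))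
    ... | inj₂ j∈n with hasUp? filling c | j∈n
    ...   | yes up | here refl = inj₂ (refl , up)

    ∈-inserted⁺ : ∀ {c j} → Born j c → j ∈ inserted c
    ∈-inserted⁺ {c} (inj₁ l) = ∈-++⁺ˡ (∈-filter⁺ (λ i → left? filling i c) (rows-complete shape _) l)
    ∈-inserted⁺ {c} (inj₂ (refl , up)) = ∈-++⁺ʳ (lefts c) go
      where
      go : c ∈ newColumn c
      go with hasUp? filling c
      ... | yes _  = here refl
      ... | no ¬up = contradiction up ¬up

    newColumn-HasUp : ∀ {c} → HasUp filling c → newColumn c ≡ [ c ]
    newColumn-HasUp {c} up with hasUp? filling c
    ... | yes _  = refl
    ... | no ¬up = contradiction up ¬up

    newColumn-¬HasUp : ∀ {c} → ¬ HasUp filling c → newColumn c ≡ []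
    newColumn-¬HasUp {c} ¬up with hasUp? filling c
    ... | yes up = contradiction up ¬up
    ... | no _   = refl

    lefts-def : ∀ c → lefts c ≡ filter (λ i → left? filling i c) rows
    lefts-def c = refl

  -- The default `c` is right in both cases: with `↑` it is the new letter, and without `↑` it is
  -- `top c` itself.
  segment-head : ∀ ls c → ∃ λ v → ls ++ (newColumn c ∷ʳ top c) ≡ headOr ls c ∷ v
  segment-head (l ∷ ls) c = _ , refl
  segment-head []       c with hasUp? filling c
  ... | yes up = _ , cong (_∷ʳ top c) (newColumn-HasUp up)
  ... | no ¬up = _ , cong₂ _∷ʳ_ (newColumn-¬HasUp ¬up) (¬HasUp⇒top ¬up)

  -- block cs r is the part of the final word that the row r has become once
  -- the columns cs have been treated, and leader cs r is its first letter.
  block : List (Fin n) → Fin n → List (Fin n)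
  block []       r = [ r ]
  block (c ∷ cs) r with top c ≟ r
  ... | yes _ = concatMap (block cs) (lefts c ++ (newColumn c ∷ʳ top c))
  ... | no  _ = block cs r

  leader : List (Fin n) → Fin n → Fin n
  leader []       r = r
  leader (c ∷ cs) r with top c ≟ r
  ... | yes _ = leader cs (headOr (lefts c) c)
  ... | no  _ = leader cs r

  block-head : ∀ cs r → ∃ λ v → block cs r ≡ leader cs r ∷ v
  block-head []       r = [] , refl
  block-head (c ∷ cs) r with top c ≟ r
  ... | no _  = block-head cs r
  ... | yes _ with segment-head (lefts c) c | block-head cs (headOr (lefts c) c)
  ...   | v , eq | w , eq′ = _ , trans (cong (concatMap (block cs)) eq)
    (cong (_++ concatMap (block cs) v) eq′)

  -- Insertions are made only in front of a letter, so `r` stays last. The letters put before it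
  -- exceed it, and inside their own blocks nothing is smaller than they are.
  block-last : ∀ cs → Suffix cs → ∀ r →
    ∃ λ u → block cs r ≡ u ∷ʳ r × All (λ j → signed T r ℤ.< signed T j) u
  block-last []       s r = [] , refl , []
  block-last (c ∷ cs) s r with top c ≟ r
  ... | no _     = block-last cs (Suffix-tail s) r
  ... | yes refl with block-last cs (Suffix-tail s) r
  ...   | u , eq , r<u = concatMap (block cs) (inserted c) ++ u ,
    trans (cong (concatMap (block cs)) (sym (++-assoc (lefts c) (newColumn c) [ r ])))
      (trans (concatMap-++ (block cs) (inserted c) [ r ])
        (trans (cong (concatMap (block cs) (inserted c) ++_) (trans (++-identityʳ _) eq))
          (sym (++-assoc (concatMap (block cs) (inserted c)) u [ r ])))) ,
    Allₚ.++⁺ (Allₚ.concat⁺ (Allₚ.map⁺ (All.tabulate λ {l} l∈ →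
      let r<l = Born⇒top-≺ (All.head (Suffix-col s)) (∈-inserted⁻ l∈)
          u′ , eq′ , l<u′ = block-last cs (Suffix-tail s) l
      in subst (All _) (sym eq′) (Allₚ.++⁺ (All.map (ℤₚ.<-trans r<l) l<u′) (r<l ∷ [])))))
      r<u

  -- No column `d < c` inserts in front of `c`, because the row with index `c` has no cell in Column
  -- `d`.
  leader-later : ∀ {c} cs → All (_< c) cs → All (λ d → kind shape d ≡ col) cs → leader cs c ≡ c
  leader-later []       _          _        = refl
  leader-later {c} (d ∷ cs) (d<c ∷ <c) (kd ∷ k) with top d ≟ c
  ... | yes eq = contradiction eq (top≢later d<c kd)
  ... | no _   = leader-later cs <c k

  leader-column : ∀ {c cs} → Suffix (c ∷ cs) → leader cs c ≡ c
  leader-column s = leader-later _ (proj₂ (Suffix-ordered s)) (Suffix-col (Suffix-tail s))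

  Born⇒Alive : ∀ {j c cs} → Suffix (c ∷ cs) → Born j c → Alive cs j
  Born⇒Alive s b = All.tabulate λ d∈ b′ → Finₚ.<⇒≢ (All.lookup (proj₂ (Suffix-ordered s)) d∈)
    (Born-functional (All.lookup (Suffix-col s) (there d∈)) (All.head (Suffix-col s)) b′ b)

  top-Alive : ∀ {c cs} → Suffix (c ∷ cs) → Alive (c ∷ cs) (top c)
  top-Alive s with All.head (Suffix-col s) | All.tail (Suffix-col s)
  ... | kc | k = top-unborn ℕₚ.≤-refl kc kc ∷ All.tabulate λ d∈ →
    top-unborn (ℕₚ.<⇒≤ (All.lookup (proj₂ (Suffix-ordered s)) d∈)) kc (All.lookup k d∈)

  Arrow⇒Alive : ∀ {i c cs} → Suffix (c ∷ cs) → Arrow filling i c → Alive cs i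
  Arrow⇒Alive s (inj₁ up) = subst (Alive _) (Up⇒top up) (All.tail (top-Alive s))
  Arrow⇒Alive s (inj₂ l)  = Born⇒Alive s (inj₁ l)

  -- Travelling through the columns that remain.

  Turns : Fin n → Fin n → Set
  Turns i c = i ≡ c ⊎ Arrow filling i c

  -- A `←` would make `i` born at `c`, so the turn is at `↑` or at the diagonal of a column without
  -- `↑`. With the converse below, the path along a row already in the word branches exactly as
  -- `block` and `leader` do.
  Turns⇒top : ∀ {i c} → ¬ Born i c → Turns i c → top c ≡ i
  Turns⇒top {c = c} ¬b (inj₁ refl)     = ¬HasUp⇒top λ up → ¬b (inj₂ (refl , up))
  Turns⇒top ¬b (inj₂ (inj₁ up)) = Up⇒top up
  Turns⇒top ¬b (inj₂ (inj₂ l))  = contradiction (inj₁ l) ¬b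

  top⇒Turns : ∀ {i c} → top c ≡ i → Turns i c
  top⇒Turns {c = c} refl with hasUp? filling c
  ... | yes up = inj₂ (inj₁ (HasUp⇒top-Up up))
  ... | no ¬up = inj₁ (¬HasUp⇒top ¬up)

  After : Fin n → List (Fin n) → Set
  After i below = ∃ λ p → rows ≡ p ++ i ∷ below

  After-tail : ∀ {p x below} → rows ≡ p ++ x ∷ below → rows ≡ (p ∷ʳ x) ++ below
  After-tail {p} {x} {below} eq = trans eq (sym (++-assoc p [ x ] below))

  After-Above : ∀ {i below} → After i below → All (Above shape i) below
  After-Above (p , eq) with _ , r ∷ _ , _ ← AllPairs-++⁻ p (subst (AllPairs _) eq (rows-sorted shape)) = r

  belowOf : Fin n → List (Fin n)
  belowOf i = filter (above? shape i) rows

  After⇒belowOf : ∀ {i below} → After i below → belowOf i ≡ below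
  After⇒belowOf {i} (p , eq) = trans (cong (filter (above? shape i)) eq)
    (filter-sorted (above? shape) ℤₚ.<-asym p (subst (AllPairs _) eq (rows-sorted shape)))

  After-belowOf : ∀ i → After i (belowOf i)
  After-belowOf i with ∈-∃++ (rows-complete shape i)
  ... | p , q , eq = p , trans eq (cong (λ b → p ++ i ∷ b) (sym (After⇒belowOf (p , eq))))

  -- The only `↑` of the column would be at `top c`, which is not among the rows below `i`.
  arrows-below : ∀ {i c below} → After i below → ¬ Above shape i (top c) →
    filter (λ j → arrow? filling j c) below ≡ filter (λ j → left? filling j c) below
  arrows-below {i} {c} a ¬above = filter-cong-local _ _ (All.map
    (λ above → [ (λ up → contradiction (subst (Above shape i) (sym (Up⇒top up)) above) ¬above) , id ]′ , inj₂)
    (After-Above a))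

  lefts-below-top : ∀ {c below} → After (top c) below →
    filter (λ j → left? filling j c) below ≡ lefts c
  lefts-below-top {c} a@(p , eq) = sym (trans (lefts-def c) (trans (cong (filter L?) eq)
    (trans (filter-++ L? p _) (cong₂ _++_
      (filter-none L? (All.map (λ r l → ℤₚ.<-asym (Left⇒below-top l) (All.head r))
        (proj₂ (proj₂ (AllPairs-++⁻ p (subst (AllPairs _) eq (rows-sorted shape)))))))
      (filter-reject L? λ l → ℤₚ.<-irrefl refl (Left⇒below-top l))))))
    where L? = λ j → left? filling j c

  -- Separated out so that the mutual recursion of the path splits into two inductions: over the
  -- rows for travel south, assuming this for the columns further right, and over the columns for
  -- travel east.
  EastCorrect : List (Fin n) → Set
  EastCorrect cs = ∀ i below → After i below → Alive cs i → travelEast T i below cs ≡ leader cs i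

  travelSouth-turn : ∀ {i c below cs} → Arrow filling i c →
    travelSouth T c (i ∷ below) cs ≡ travelEast T i below cs
  travelSouth-turn {i} {c} a with arrow? filling i c
  ... | yes _ = refl
  ... | no ¬a = contradiction a ¬a

  travelSouth-pass : ∀ {i c below cs} → ¬ Arrow filling i c →
    travelSouth T c (i ∷ below) cs ≡ travelSouth T c below cs
  travelSouth-pass {i} {c} ¬a with arrow? filling i c
  ... | yes a = contradiction a ¬a
  ... | no _  = refl

  -- The path turns at the first arrow it meets, into a row already in the word after Column `c`,
  -- where `east` applies. If there is no arrow it leaves through `c`, which is its own leader.
  south-correct : ∀ {c cs} → Suffix (c ∷ cs) → EastCorrect cs → ∀ p below → rows ≡ p ++ below →
    travelSouth T c below cs ≡ leader cs (headOr (filter (λ j → arrow? filling j c) below) c)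
  south-correct s east p [] eq = sym (leader-column s)
  south-correct {c} {cs} s east p (i ∷ below) eq = case arrow? filling i c of λ where
    (yes a) → trans (travelSouth-turn a) (trans (east i below (p , eq) (Arrow⇒Alive s a))
      (cong (λ l → leader cs (headOr l c)) (sym (filter-accept A? a))))
    (no ¬a) → trans (travelSouth-pass ¬a) (trans (south-correct s east (p ∷ʳ i) below (After-tail eq))
      (cong (λ l → leader cs (headOr l c)) (sym (filter-reject A? ¬a))))
   where A? = λ j → arrow? filling j c

  south-correct-below : ∀ {c cs} → Suffix (c ∷ cs) → EastCorrect cs → ∀ {i below} → After i below →
    ¬ Above shape i (top c) →
    travelSouth T c below cs ≡ leader cs (headOr (filter (λ j → left? filling j c) below) c)
  south-correct-below {c} {cs} s east {i} {below} a@(p , eq) ¬above =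
    trans (south-correct s east (p ∷ʳ i) below (After-tail eq))
      (cong (λ l → leader cs (headOr l c)) (arrows-below a ¬above))

  -- In the row `top c` the path turns down Column `c`, and all `←` of the column lie below. The
  -- first of them, or `c` if there is none, is the index to which `leader` passes as well. In any
  -- other row both go on to the next column.
  east-correct : ∀ cs → Suffix cs → EastCorrect cs
  east-correct []       s i below a alive = refl
  east-correct (c ∷ cs) s i below a (¬b ∷ alive) with (i ≟ c) ⊎-dec arrow? filling i c | top c ≟ i
  ... | yes t | no t≢    = contradiction (Turns⇒top ¬b t) t≢
  ... | no ¬t | yes t≡   = contradiction (top⇒Turns t≡) ¬t
  ... | no _  | no _     = east-correct cs (Suffix-tail s) i below a alive
  ... | yes _ | yes refl =
    trans (south-correct-below s (east-correct cs (Suffix-tail s)) a (ℤₚ.<-irrefl refl))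
      (cong (λ l → leader cs (headOr l c)) (lefts-below-top a))

  -- Exits of paths that start at the left border.

  exit-turn : ∀ {i c cs} (s : Suffix (c ∷ cs)) → All (λ d → ¬ Turns i d) (proj₁ s) → Turns i c →
    exit T i ≡ travelSouth T c (belowOf i) cs
  exit-turn {i} {c} {cs} (p , eq) ¬t t = trans (cong (travelEast T i (belowOf i)) eq) (go p ¬t)
    where
    go : ∀ p → All (λ d → ¬ Turns i d) p →
      travelEast T i (belowOf i) (p ++ c ∷ cs) ≡ travelSouth T c (belowOf i) cs
    go [] [] with (i ≟ c) ⊎-dec arrow? filling i c
    ... | yes _ = refl
    ... | no ¬t = contradiction t ¬t
    go (d ∷ p) (¬t ∷ ¬ts) with (i ≟ d) ⊎-dec arrow? filling i d
    ... | yes t = contradiction t ¬t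
    ... | no _  = go p ¬ts

  prefix-col : ∀ {cs} (s : Suffix cs) → All (λ d → kind shape d ≡ col) (proj₁ s)
  prefix-col (p , eq) = Allₚ.++⁻ˡ p (subst (All _) eq (columns-col shape))

  -- Nothing turns the path before Column `c`: the diagonal is not further left than `c`, an `↑`
  -- there would violate `no-bad-zero`, and a row has a single `←`. From `c` on it runs south, below
  -- `top c`.
  exit-Left : ∀ {l c cs} → Suffix (c ∷ cs) → Left filling l c →
    exit T l ≡ leader cs (headOr (filter (λ j → left? filling j c) (belowOf l)) c)
  exit-Left {l} {c} {cs} s left@(_ , ((p , z) , _) , _) =
    trans (exit-turn s (All.map ¬turn (proj₁ (Suffix-ordered s))) (inj₂ (inj₂ left)))
      (south-correct-below s (east-correct _ (Suffix-tail s)) (After-belowOf l)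
        (ℤₚ.<-asym (Left⇒below-top left)))
    where
    ¬turn : ∀ {d} → c < d → ¬ Turns l d
    ¬turn c<d (inj₁ refl) = ℕₚ.<⇒≱ c<d (cell-≤ shape p)
    ¬turn c<d (inj₂ (inj₁ (_ , o , _))) = no-bad-zero _ _ (p , z) (Left⇒OneAbove left , _ , c<d , o)
    ¬turn c<d (inj₂ (inj₂ (_ , _ , ¬smaller))) = ¬smaller (c , c<d , proj₁ (proj₂ left))

  -- Row `−c` has no arrow, so the path goes to the diagonal and then down Column `c`. The first
  -- arrow there is `↑`, since each `←` lies below it.
  exit-HasUp : ∀ {c cs} → Suffix (c ∷ cs) → HasUp filling c → exit T c ≡ leader cs (top c)
  exit-HasUp {c} {cs} s up with HasUp⇒top-Up up | After-belowOf c
  ... | up′@(t≢c , o , ¬above) | p , eq =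
    trans (exit-turn s (All.zipWith ¬turn (proj₁ (Suffix-ordered s) , prefix-col s)) (inj₁ refl))
    (trans (south-correct s (east-correct _ (Suffix-tail s)) (p ∷ʳ c) (belowOf c) (After-tail eq))
      (cong (leader cs) (headOr-filter-sorted (λ j → arrow? filling j c) {xs = belowOf c}
        (proj₁ (proj₂ (AllPairs-++⁻ (p ∷ʳ c)
          (subst (AllPairs _) (After-tail eq) (rows-sorted shape)))))
        (∈-filter⁺ (above? shape c) (rows-complete shape _) (diagonal-Above shape (proj₁ o) t≢c))
        (inj₁ up′)
        λ { (inj₁ (_ , o′ , _)) above → ¬above (_ , above , o′)
          ; (inj₂ l) above → ℤₚ.<-asym (Left⇒below-top l) above })))
    where
    kc = All.head (Suffix-col s)
    ¬turn : ∀ {d} → c < d × kind shape d ≡ col → ¬ Turns c d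
    ¬turn (c<d , kd) (inj₁ refl) = Finₚ.<-irrefl refl c<d
    ¬turn (c<d , kd) (inj₂ (inj₁ (_ , o , _))) = One⇒Plain o (kc , up)
    ¬turn (c<d , kd) (inj₂ (inj₂ l)) = Left⇒Plain l (kc , up)

  -- The path from a row with `←` meets the next `←` of the column or leaves through its bottom; the
  -- path from a column with `↑` turns into `top c`. In each case this is where the next letter's
  -- block begins.
  segment-linked : ∀ {c cs} → Suffix (c ∷ cs) →
    Linked (λ l l′ → exit T l ≡ leader cs l′) (lefts c ++ (newColumn c ∷ʳ top c))
  segment-linked {c} {cs} s =
    subst (λ ls → Chain (ls ++ (newColumn c ∷ʳ top c))) (sym (lefts-def c)) (go [] rows refl)
    where
    L? = λ j → left? filling j c
    Chain = Linked (λ l l′ → exit T l ≡ leader cs l′)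
    tail-linked : Chain (newColumn c ∷ʳ top c)
    tail-linked with hasUp? filling c
    ... | yes up = subst (λ us → Chain (us ∷ʳ top c)) (sym (newColumn-HasUp up)) (exit-HasUp s up ∷ [-])
    ... | no ¬up = subst (λ us → Chain (us ∷ʳ top c)) (sym (newColumn-¬HasUp ¬up)) [-]
    cons : ∀ {l xs y v} → xs ≡ y ∷ v → exit T l ≡ leader cs y → Chain xs → Chain (l ∷ xs)
    cons refl e ch = e ∷ ch
    go : ∀ p below → rows ≡ p ++ below → Chain (filter L? below ++ (newColumn c ∷ʳ top c))
    go p [] eq = tail-linked
    go p (x ∷ below) eq = case left? filling x c of λ where
      (no ¬l) → subst (λ ls → Chain (ls ++ _)) (sym (filter-reject L? ¬l)) ih
      (yes l) → subst (λ ls → Chain (ls ++ _)) (sym (filter-accept L? l))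
        (cons (proj₂ (segment-head (filter L? below) c))
          (trans (exit-Left s l)
            (cong (λ b → leader cs (headOr (filter L? b) c)) (After⇒belowOf (p , eq))))
          ih)
     where ih = go (p ∷ʳ x) below (After-tail eq)

  -- The block of a letter `l` ends in `l`, and the next block begins with its leader, which is the
  -- exit of `l`; so the two meet where the blocks are joined. Letters inside a block are settled by
  -- induction.
  block-adjacent : ∀ cs → Suffix cs → ∀ r {j} → j ∈ block cs r →
    j ≡ r ⊎ Adjacent (block cs r) j (exit T j)
  block-adjacent []       s r (here eq) = inj₁ eq
  block-adjacent (c ∷ cs) s r j∈ with top c ≟ r
  ... | no _     = block-adjacent cs (Suffix-tail s) r j∈
  ... | yes refl = go (lefts c ++ (newColumn c ∷ʳ r)) (lefts c ++ newColumn c)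
      (sym (++-assoc (lefts c) _ _)) (segment-linked s) j∈
    where
    -- The witness `us` records that the segment ends in `r`, the one letter left without a
    -- successor.
    go : ∀ {r j} ls us → ls ≡ us ∷ʳ r → Linked (λ l l′ → exit T l ≡ leader cs l′) ls →
      j ∈ concatMap (block cs) ls → j ≡ r ⊎ Adjacent (concatMap (block cs) ls) j (exit T j)
    go (l ∷ ls) us eq ch j∈ with ∈-++⁻ (block cs l) j∈
    go (l ∷ ls) us eq ch j∈ | inj₁ j∈l with block-adjacent cs (Suffix-tail s) l j∈l
    ... | inj₂ adj = inj₂ (Adjacent-++ [] _ adj)
    go (l ∷ []) [] refl ch j∈ | inj₁ j∈l | inj₁ refl = inj₁ refl
    go (l ∷ []) (_ ∷ []) () ch j∈ | inj₁ j∈l | inj₁ refl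
    go (l ∷ []) (_ ∷ _ ∷ _) () ch j∈ | inj₁ j∈l | inj₁ refl
    go (l ∷ l′ ∷ ls) us eq (e ∷ ch) j∈ | inj₁ j∈l | inj₁ refl
      with block-last cs (Suffix-tail s) l | block-head cs l′
    ... | u , equ , _ | v , eqv = inj₂ (u , v ++ concatMap (block cs) ls ,
      trans (cong₂ _++_ equ (cong (_++ concatMap (block cs) ls) eqv))
        (trans (++-assoc u [ l ] _)
          (cong (λ y → u ++ l ∷ y ∷ v ++ concatMap (block cs) ls) (sym e))))
    go (l ∷ l′ ∷ ls) (_ ∷ us) eq (_ ∷ ch) j∈ | inj₂ j∈ls
      with go (l′ ∷ ls) us (proj₂ (∷-injective eq)) ch j∈ls
    ... | inj₁ j≡r = inj₁ j≡r
    ... | inj₂ adj = inj₂ (subst (λ a → Adjacent a _ _)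
      (cong (block cs l ++_) (++-identityʳ _)) (Adjacent-++ (block cs l) [] adj))

-- Insertion into words, and transport of permutation graphs.

insertBefore-++ : ∀ xs {a} p {q} → All (_≢ a) p →
  insertBefore xs a (p ++ a ∷ q) ≡ just (p ++ xs ++ a ∷ q)
insertBefore-++ xs {a} [] [] with a ℤₚ.≟ a
... | yes _ = refl
... | no ≢  = contradiction refl ≢
insertBefore-++ xs {a} (y ∷ p) (y≢a ∷ p≢a) with y ℤₚ.≟ a
... | yes y≡a = contradiction y≡a y≢a
... | no _    = cong (Maybe.map (y ∷_)) (insertBefore-++ xs p p≢a)

tabulate-toℕ : ∀ {A : Set} (f : ℕ → A) n → tabulate {n = n} (f ∘ toℕ) ≡ applyUpTo f n
tabulate-toℕ f zero    = refl
tabulate-toℕ f (suc n) = cong (f 0 ∷_) (tabulate-toℕ (f ∘ suc) n)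

IsPermutationOf-resp : ∀ {S S′ f} → (∀ x → x ∈ S ⇔ x ∈ S′) → IsPermutationOf S f → IsPermutationOf S′ f
IsPermutationOf-resp S⇔S′ p = record
  { within   = λ fxy → to (proj₁ (within fxy)) , to (proj₂ (within fxy))
  ; image    = image ∘ from
  ; preimage = preimage ∘ from
  }
  where
  open IsPermutationOf p
  to   = λ {x} → Equivalence.to (S⇔S′ x)
  from = λ {x} → Equivalence.from (S⇔S′ x)

IsPermutationOf-≐ : ∀ {S f g} → (∀ x y → f x y ⇔ g x y) → IsPermutationOf S g → IsPermutationOf S f
IsPermutationOf-≐ f⇔g p = record
  { within   = within ∘ to
  ; image    = λ x∈ → let y , gxy , uniq = image x∈ in y , from gxy , uniq ∘ to
  ; preimage = λ y∈ → let x , gxy , uniq = preimage y∈ in x , from gxy , uniq ∘ to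
  }
  where
  open IsPermutationOf p
  to   = λ {x y} → Equivalence.to (f⇔g x y)
  from = λ {x y} → Equivalence.from (f⇔g x y)

Adjacent-map : ∀ {A B : Set} (f : A → B) {a x y} → Adjacent a x y → Adjacent (map f a) (f x) (f y)
Adjacent-map f {x = x} {y} (u , v , refl) = map f u , map f v , map-++ f u (x ∷ y ∷ v)

-- The insertion algorithm.

module FinalWord {n} (T : PTB n) where
  open Zigzag T

  s : Fin n → ℤ
  s = signed T

  leftArrowRows-signed : ∀ c → leftArrowRows T c ≡ map s (lefts c)
  leftArrowRows-signed c = sym (trans (cong (map s) (lefts-def c)) (map-cong-local
    (All.map (signed-plain ∘ Left⇒Plain) (Allₚ.all-filter (λ i → left? filling i c) rows))))

  signed-fresh : ∀ {t p} → All (_≢ t) p → All (_≢ s t) (map s p)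
  signed-fresh = Allₚ.map⁺ ∘ All.map (_∘ signed-injective)

  insertBefore-signed : ∀ xs t p q → All (_≢ t) p →
    insertBefore (map s xs) (s t) (map s (p ++ t ∷ q)) ≡ just (map s (p ++ xs ++ t ∷ q))
  insertBefore-signed xs t p q p≢t = begin
    insertBefore (map s xs) (s t) (map s (p ++ t ∷ q))
      ≡⟨ cong (insertBefore (map s xs) (s t)) (map-++ s p (t ∷ q)) ⟩
    insertBefore (map s xs) (s t) (map s p ++ s t ∷ map s q)
      ≡⟨ insertBefore-++ (map s xs) (map s p) (signed-fresh p≢t) ⟩
    just (map s p ++ map s xs ++ map s (t ∷ q))
      ≡⟨ cong (λ w → just (map s p ++ w)) (map-++ s xs (t ∷ q)) ⟨
    just (map s p ++ map s (xs ++ t ∷ q))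
      ≡⟨ cong just (map-++ s p (xs ++ t ∷ q)) ⟨
    just (map s (p ++ xs ++ t ∷ q)) ∎
    where open ≡-Reasoning

  -- Words of indices are read through `s`, which agrees with the letters used by the algorithm:
  -- `s (top c)` is the label of the row of `↑`, or `−c` when there is none.
  insertColumn-signed : ∀ {c} → kind shape c ≡ col → ∀ p q →
    All (_≢ top c) p → All (λ j → ¬ Born j c) p →
    insertColumn T (map s (p ++ top c ∷ q)) c ≡ just (map s (p ++ inserted c ++ top c ∷ q))
  insertColumn-signed {c} kc p q p≢t ¬b with hasUp? filling c
  ... | no ¬up = begin
    insertBefore (leftArrowRows T c) (- label c) w
      ≡⟨ cong₂ (λ L a → insertBefore L a w) (leftArrowRows-signed c) (sym st) ⟩
    insertBefore (map s (lefts c)) (s (top c)) w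
      ≡⟨ insertBefore-signed (lefts c) (top c) p q p≢t ⟩
    just (map s (p ++ lefts c ++ top c ∷ q))
      ≡⟨ cong (λ u → just (map s (p ++ u))) (trans (sym (++-assoc (lefts c) [] (top c ∷ q)))
           (cong (λ us → (lefts c ++ us) ++ top c ∷ q) (sym (newColumn-¬HasUp ¬up)))) ⟩
    just (map s (p ++ inserted c ++ top c ∷ q)) ∎
    where
    open ≡-Reasoning
    w = map s (p ++ top c ∷ q)
    st : s (top c) ≡ - label c
    st = trans (cong s (¬HasUp⇒top ¬up)) (trans (signed-plain (¬up ∘ proj₂)) (rowLabel-col shape kc))
  ... | yes (r , up) = begin
    (insertBefore [ label c ] (rowLabel shape r) w >>= insertBefore (leftArrowRows T c) (label c))
      ≡⟨ cong (_>>= insertBefore (leftArrowRows T c) (label c))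
           (cong₂ (λ l a → insertBefore [ l ] a w) (sym sc) (sym sr)) ⟩
    (insertBefore [ s c ] (s (top c)) w >>= insertBefore (leftArrowRows T c) (label c))
      ≡⟨ cong (_>>= insertBefore (leftArrowRows T c) (label c))
           (insertBefore-signed [ c ] (top c) p q p≢t) ⟩
    insertBefore (leftArrowRows T c) (label c) (map s (p ++ c ∷ top c ∷ q))
      ≡⟨ cong₂ (λ L a → insertBefore L a (map s (p ++ c ∷ top c ∷ q))) (leftArrowRows-signed c) (sym sc) ⟩
    insertBefore (map s (lefts c)) (s c) (map s (p ++ c ∷ top c ∷ q))
      ≡⟨ insertBefore-signed (lefts c) c p (top c ∷ q)
           -- A `c` already in `p` would be born at `c`, so the search stops at the `c` just
           -- inserted.
           (All.map (λ { ¬b refl → ¬b (inj₂ (refl , r , up)) }) ¬b) ⟩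
    just (map s (p ++ lefts c ++ c ∷ top c ∷ q))
      ≡⟨ cong (λ u → just (map s (p ++ u))) (trans (sym (++-assoc (lefts c) [ c ] (top c ∷ q)))
           (cong (λ us → (lefts c ++ us) ++ top c ∷ q) (sym (newColumn-HasUp (r , up))))) ⟩
    just (map s (p ++ inserted c ++ top c ∷ q)) ∎
    where
    open ≡-Reasoning
    w = map s (p ++ top c ∷ q)
    sc : s c ≡ label c
    sc = signed-up (r , up)
    sr : s (top c) ≡ rowLabel shape r
    sr = trans (cong s (Up⇒top up)) (signed-plain (One⇒Plain (proj₁ (proj₂ up))))

  inserted-unique : ∀ c → Unique (inserted c)
  inserted-unique c = Uniqueₚ.++⁺
    (subst Unique (sym (lefts-def c)) (Uniqueₚ.filter⁺ (λ i → left? filling i c) rows-unique))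
    newColumn-unique disjoint
    where
    newColumn-unique : Unique (newColumn c)
    newColumn-unique with hasUp? filling c
    ... | yes up = subst Unique (sym (newColumn-HasUp up)) ([] ∷ [])
    ... | no ¬up = subst Unique (sym (newColumn-¬HasUp ¬up)) []
    disjoint : ∀ {j} → ¬ (j ∈ lefts c × j ∈ newColumn c)
    disjoint {j} (j∈l , j∈n) with hasUp? filling c
    ... | no ¬up with () ← subst (j ∈_) (newColumn-¬HasUp ¬up) j∈n
    ... | yes up with subst (j ∈_) (newColumn-HasUp up) j∈n
    ...   | here refl = proj₁ (proj₂ (∈-filter⁻ (λ i → left? filling i c) {xs = rows}
      (subst (c ∈_) (lefts-def c) j∈l))) refl

  expand : List (Fin n) → List (Fin n) → List (Fin n)
  expand cs = concatMap (block cs)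

  -- The invariant of the word while the columns `cs` remain. For `cs` empty it says that every
  -- index occurs exactly once.
  record Stage (cs v : List (Fin n)) : Set where
    field
      unique   : Unique v
      alive    : ∀ {j} → j ∈ v → Alive cs j
      complete : ∀ j → Alive cs j → j ∈ v

  block-step : ∀ {c cs r} → r ≢ top c → block (c ∷ cs) r ≡ block cs r
  block-step {c} {r = r} r≢t with top c ≟ r
  ... | yes t≡r = contradiction (sym t≡r) r≢t
  ... | no _    = refl

  block-top : ∀ c cs → block (c ∷ cs) (top c) ≡ expand cs (inserted c) ++ block cs (top c)
  block-top c cs with top c ≟ top c
  ... | no t≢t = contradiction refl t≢t
  ... | yes _  = begin
    expand cs (lefts c ++ (newColumn c ∷ʳ top c))
      ≡⟨ cong (expand cs) (++-assoc (lefts c) (newColumn c) [ top c ]) ⟨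
    expand cs (inserted c ∷ʳ top c)
      ≡⟨ concatMap-++ (block cs) (inserted c) [ top c ] ⟩
    expand cs (inserted c) ++ block cs (top c) ++ []
      ≡⟨ cong (expand cs (inserted c) ++_) (++-identityʳ _) ⟩
    expand cs (inserted c) ++ block cs (top c) ∎
    where open ≡-Reasoning

  -- Treating a column does not change the expansion: what `block` would still have unfolded at
  -- `top c` has now been written out.
  expand-step : ∀ c cs p q → All (_≢ top c) p → All (_≢ top c) q →
    expand (c ∷ cs) (p ++ top c ∷ q) ≡ expand cs (p ++ inserted c ++ top c ∷ q)
  expand-step c cs p q p≢ q≢ = begin
    expand (c ∷ cs) (p ++ top c ∷ q)
      ≡⟨ concatMap-++ (block (c ∷ cs)) p (top c ∷ q) ⟩
    expand (c ∷ cs) p ++ block (c ∷ cs) (top c) ++ expand (c ∷ cs) q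
      ≡⟨ cong₂ _++_ (unchanged p≢) (cong₂ _++_ (block-top c cs) (unchanged q≢)) ⟩
    expand cs p ++ (expand cs (inserted c) ++ block cs (top c)) ++ expand cs q
      ≡⟨ cong (expand cs p ++_) (++-assoc (expand cs (inserted c)) (block cs (top c)) (expand cs q)) ⟩
    expand cs p ++ expand cs (inserted c) ++ expand cs (top c ∷ q)
      ≡⟨ cong (expand cs p ++_) (concatMap-++ (block cs) (inserted c) (top c ∷ q)) ⟨
    expand cs p ++ expand cs (inserted c ++ top c ∷ q)
      ≡⟨ concatMap-++ (block cs) p (inserted c ++ top c ∷ q) ⟨
    expand cs (p ++ inserted c ++ top c ∷ q) ∎
    where
    open ≡-Reasoning
    unchanged : ∀ {v} → All (_≢ top c) v → expand (c ∷ cs) v ≡ expand cs v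
    unchanged = cong concat ∘ map-cong-local ∘ All.map block-step

  -- The letters alive after Column `c` are those alive before together with those born at `c`, and
  -- the latter are exactly the inserted ones.
  Stage-step : ∀ {c cs} → Suffix (c ∷ cs) → ∀ p q →
    Stage (c ∷ cs) (p ++ top c ∷ q) → Stage cs (p ++ inserted c ++ top c ∷ q)
  Stage-step {c} {cs} sf p q st = record
    { unique   = PermSₚ.Unique-resp-↭ (setoid _) (↭⇒↭ₛ (↭-sym moved))
        (Uniqueₚ.++⁺ (inserted-unique c) unique
          λ (j∈i , j∈v) → All.head (alive j∈v) (∈-inserted⁻ j∈i))
    ; alive    = λ j∈ → case ∈-++⁻ (inserted c) (∈-resp-↭ moved j∈) of λ where
        (inj₁ j∈i) → Born⇒Alive sf (∈-inserted⁻ j∈i)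
        (inj₂ j∈v) → All.tail (alive j∈v)
    ; complete = λ j al → ∈-resp-↭ (↭-sym moved) (∈-moved j al)
    }
    where
    open Stage st
    open DecMembership (_≟_ {n}) using (_∈?_)
    moved : p ++ inserted c ++ top c ∷ q ↭ inserted c ++ p ++ top c ∷ q
    moved = shifts p (inserted c)
    ∈-moved : ∀ j → Alive cs j → j ∈ inserted c ++ p ++ top c ∷ q
    ∈-moved j al with j ∈? inserted c
    ... | yes j∈i = ∈-++⁺ˡ j∈i
    ... | no j∉i  = ∈-++⁺ʳ (inserted c) (complete j ((j∉i ∘ ∈-inserted⁺) ∷ al))

  step : Maybe Word → Fin n → Maybe Word
  step w c = w >>= λ v → insertColumn T v c

  -- No insertion fails: `top c` is alive, hence occurs in the word by completeness, and only once.
  -- The expansion being invariant, the final word is that of the current one.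
  insertColumns-expand : ∀ cs → Suffix cs → ∀ v → Stage cs v →
    foldl step (just (map s v)) cs ≡ just (map s (expand cs v)) × Stage [] (expand cs v)
  insertColumns-expand [] sf v st =
    cong (just ∘ map s) (sym (concatMap-pure v)) , subst (Stage []) (sym (concatMap-pure v)) st
  insertColumns-expand (c ∷ cs) sf v st with ∈-∃++ (Stage.complete st (top c) (top-Alive sf))
  ... | p , q , refl with AllPairs-++⁻ p (Stage.unique st)
  ...   | _ , t∉q ∷ _ , p∉ with insertColumns-expand cs (Suffix-tail sf) _ (Stage-step sf p q st)
  ...     | eq , st′ =
    trans (cong (λ w → foldl step w cs) (insertColumn-signed (All.head (Suffix-col sf)) p q p≢
        (All.tabulate λ j∈ → All.head (Stage.alive st (∈-++⁺ˡ j∈)))))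
      (trans eq (cong (just ∘ map s) (sym expanded))) ,
    subst (Stage []) (sym expanded) st′
    where
    p≢ = All.map All.head p∉
    expanded = expand-step c cs p q p≢ (All.map (_∘ sym) t∉q)

  -- The final word and its cycles.

  opaque
    roots : List (Fin n)
    roots = filter (unrestricted? filling) rows

    roots-unrestricted : All (Unrestricted filling) roots
    roots-unrestricted = Allₚ.all-filter (unrestricted? filling) rows

    ∈-roots : ∀ {i} → Unrestricted filling i → i ∈ roots
    ∈-roots un = ∈-filter⁺ (unrestricted? filling) (rows-complete shape _) un

    roots-sorted : AllPairs (Above shape) roots
    roots-sorted = AllPairsₚ.filter⁺ (unrestricted? filling) (rows-sorted shape)

    roots-signed : initialWord T ≡ map s roots
    roots-signed = sym (map-cong-local (All.map (signed-plain ∘ Unrestricted⇒Plain) roots-unrestricted))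

  cols-suffix : Suffix cols
  cols-suffix = [] , refl

  root-alive : ∀ {i} → i ∈ roots → Alive cols i
  root-alive i∈ = All.map (λ kc → unrestricted⇒unborn kc (All.lookup roots-unrestricted i∈)) (columns-col shape)

  roots-stage : Stage cols roots
  roots-stage = record
    { unique   = AllPairs.map (λ { r refl → ℤₚ.<-irrefl refl r }) roots-sorted
    ; alive    = root-alive
    ; complete = λ j al → ∈-roots (unborn⇒unrestricted λ c kc → All.lookup al (columns-complete shape kc))
    }

  finalWord : List (Fin n)
  finalWord = expand cols roots

  Φ-finalWord : Φ T ≡ just (map s finalWord)
  Φ-finalWord = trans (cong (λ w → foldl step (just w) cols) roots-signed)
    (proj₁ (insertColumns-expand cols cols-suffix roots roots-stage))

  finalWord-stage : Stage [] finalWord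
  finalWord-stage = proj₂ (insertColumns-expand cols cols-suffix roots roots-stage)

  ∈-finalWord : ∀ i → i ∈ finalWord
  ∈-finalWord i = Stage.complete finalWord-stage i []

  finalWord-↭ : finalWord ↭ allFin n
  finalWord-↭ = ∼bag⇒↭ (unique∧set⇒bag (Stage.unique finalWord-stage) (Uniqueₚ.allFin⁺ n)
    (mk⇔ (λ _ → ∈-allFin _) (λ _ → ∈-finalWord _)))

  finalWord-typeB : TypeBPermutation n (map s finalWord)
  finalWord-typeB = begin
    map ∣_∣ (map s finalWord)        ≡⟨ map-∘ finalWord ⟨
    map (∣_∣ ∘ s) finalWord          ≡⟨ map-cong ∣signed∣ finalWord ⟩
    map (suc ∘ toℕ) finalWord        ↭⟨ Permₚ.map⁺ (suc ∘ toℕ) finalWord-↭ ⟩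
    map (suc ∘ toℕ) (allFin n)       ≡⟨ map-tabulate (λ i → i) (suc ∘ toℕ) ⟩
    tabulate (suc ∘ toℕ)             ≡⟨ tabulate-toℕ suc n ⟩
    applyUpTo suc n                  ∎
    where open PermutationReasoning

  R⇔finalWord : ∀ x → x ∈ R T ⇔ x ∈ map s finalWord
  R⇔finalWord x = mk⇔
    (λ x∈ → case ∈-map⁻ s x∈ of λ { (i , _ , refl) → ∈-map⁺ s (∈-finalWord i) })
    (λ x∈ → case ∈-map⁻ s x∈ of λ { (i , _ , refl) → ∈-map⁺ s (∈-allFin i) })

  finalWord-unique : Unique (map s finalWord)
  finalWord-unique = Uniqueₚ.map⁺ signed-injective (Stage.unique finalWord-stage)

  expand-above : ∀ {x} is → All (λ i → s x ℤ.< s i) is → All (s x ℤ.<_) (map s (expand cols is))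
  expand-above is x<is = Allₚ.map⁺ (Allₚ.concat⁺ (Allₚ.map⁺ (All.map above x<is)))
    where
    above : ∀ {x i} → s x ℤ.< s i → All (λ j → s x ℤ.< s j) (block cols i)
    above {x} {i} x<i with block-last cols cols-suffix i
    ... | u , eq , i<u = subst (All _) (sym eq) (Allₚ.++⁺ (All.map (ℤₚ.<-trans x<i) i<u) (x<i ∷ []))

  -- Every letter of a block other than its root exceeds the root, and the
  -- roots increase, so the roots are exactly the RL-minima.
  factors-expand : ∀ is → AllPairs (λ i j → s i ℤ.< s j) is →
    factors (map s (expand cols is)) ≡ map (map s ∘ block cols) is
  factors-expand [] [] = refl
  factors-expand (i ∷ is) (i<is ∷ sorted) with block-last cols cols-suffix i
  ... | u , eq , i<u = begin
    factors (map s (block cols i ++ expand cols is))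
      ≡⟨ cong factors (trans (map-++ s (block cols i) (expand cols is))
           (cong (_++ map s (expand cols is)) mapped)) ⟩
    factors ((map s u ∷ʳ s i) ++ map s (expand cols is))
      ≡⟨ factors-∷ʳ-++ (map s u) (Allₚ.map⁺ i<u) (expand-above is i<is) ⟩
    (map s u ∷ʳ s i) ∷ factors (map s (expand cols is))
      ≡⟨ cong₂ _∷_ (sym mapped) (factors-expand is sorted) ⟩
    map s (block cols i) ∷ map (map s ∘ block cols) is ∎
    where
    open ≡-Reasoning
    mapped : map s (block cols i) ≡ map s u ∷ʳ s i
    mapped = trans (cong (map s) eq) (map-++ s u [ i ])

  exit-root : ∀ {r} → r ∈ roots → exit T r ≡ leader cols r
  exit-root {r} r∈ = east-correct cols cols-suffix r (belowOf r) (After-belowOf r) (root-alive r∈)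

  -- Only the root is without a successor in its block; it is the last letter, and its path exits at
  -- the leader, the first letter, which closes the cycle.
  block-cycle : ∀ {r i} → r ∈ roots → i ∈ block cols r → cycle (map s (block cols r)) (s i) (s (exit T i))
  block-cycle {r} {i} r∈ i∈ with block-adjacent cols cols-suffix r i∈
  ... | inj₂ adj  = inj₁ (Adjacent-map s adj)
  ... | inj₁ refl with block-last cols cols-suffix r | block-head cols r
  ...   | u , equ , _ | v , eqv = inj₂
    ( trans (last-map s (block cols r)) (cong (Maybe.map s) (trans (cong last equ) (last-∷ʳ u)))
    , trans (head-map (block cols r))
        (cong (Maybe.map s) (trans (cong head eqv) (cong just (sym (exit-root r∈))))))

  φ-exit : ∀ i → φ (map s finalWord) (s i) (s (exit T i))
  φ-exit i with find (∈-concatMap⁻ (block cols) {xs = roots} (∈-finalWord i))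
  ... | r , r∈ , i∈ = subst (Any _) (sym (factors-expand roots roots-≺))
    (Anyₚ.map⁺ (Any.map (λ { refl → block-cycle r∈ i∈ }) r∈))
    where
    roots-≺ : AllPairs (λ i j → s i ℤ.< s j) roots
    roots-≺ = AllPairs-restrict
      (λ ui uj → subst₂ ℤ._<_ (sym (signed-plain (Unrestricted⇒Plain ui)))
        (sym (signed-plain (Unrestricted⇒Plain uj))))
      roots-unrestricted roots-sorted

  ζ⇔φ : ∀ x y → ζ T x y ⇔ φ (map s finalWord) x y
  ζ⇔φ x y = mk⇔ (λ { (i , refl , refl) → φ-exit i }) from
    where
    open IsPermutationOf (φ-isPermutation (map s finalWord) finalWord-unique)
    -- `φ` is single-valued and its value at `s i` is known to be `s (exit T i)`, so the inclusion
    -- of `ζ` in `φ` is already an equality.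
    from : φ (map s finalWord) x y → ζ T x y
    from fxy with ∈-map⁻ s (proj₁ (within fxy))
    ... | i , _ , refl with image (proj₁ (within fxy))
    ...   | _ , _ , uniq = i , refl , trans (sym (uniq fxy)) (uniq (φ-exit i))

theorem5p2 : ∀ (n : ℕ) → n ≥ 1 → (T : PTB n) →
    ∃ λ w → Φ T ≡ just w
    × TypeBPermutation n w
    × (∀ x → x ∈ R T ⇔ x ∈ w)
    × IsPermutationOf (R T) (ζ T)
    × IsPermutationOf (R T) (φ w)
    × (∀ x y → ζ T x y ⇔ φ w x y)
theorem5p2 n _ T =
  map s finalWord , Φ-finalWord , finalWord-typeB , R⇔finalWord ,
  -- That the zigzag map is bijective is inherited from `φ`; paths are never traced backwards.
  IsPermutationOf-≐ ζ⇔φ φ-perm , φ-perm , ζ⇔φ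
  where
  open FinalWord T
  φ-perm : IsPermutationOf (R T) (φ (map s finalWord))
  φ-perm = IsPermutationOf-resp
    (λ x → mk⇔ (Equivalence.from (R⇔finalWord x)) (Equivalence.to (R⇔finalWord x)))
    (φ-isPermutation (map s finalWord) finalWord-unique)
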